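{- $gr^3_2(B_{12})=20$.
   Context: $K_n$ is the complete graph of order $n$. The book $B_n:=K_2+nK_1$ (graph join) is the graph on $n+2$ vertices consisting of an edge $xy$ (the spine) together with $n$ further, pairwise non-adjacent vertices (the pages), each adjacent to both $x$ and $y$. A $t$-coloring of $K_p$ is a map $f:E(K_p)\to\{1,\dots,t\}$, not assumed surjective. A Gallai $t$-coloring is a $t$-coloring with no rainbow triangle, i.e. there are no three vertices $x,y,z$ such that $f(xy),f(xz),f(yz)$ are pairwise distinct. For $1\le s<t$ and a graph $G$, the weakened Gallai-Ramsey number $gr^t_s(G)$ is the least $p\in\mathbb{N}$ such that every Gallai $t$-coloring of $K_p$ contains a (not necessarily induced) subgraph isomorphic to $G$ whose edges use at most $s$ colors. -}

module Defs where

open import Data.Empty using (⊥)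
open import Data.Fin.Base using (Fin)
open import Data.Fin.Subset using (Subset; _∈_; ∣_∣)
open import Data.Nat.Base using (ℕ; _≤_)
open import Data.Product.Base using (Σ-syntax; ∃-syntax; _×_; _,_)
open import Data.Sum.Base using (_⊎_; inj₁; inj₂)
open import Data.Unit.Base using (⊤; tt)
open import Function.Definitions using (Injective)
open import Level using (0ℓ)
open import Relation.Binary.Core using (Rel)
open import Relation.Binary.Definitions using (Symmetric; Irreflexive)
open import Relation.Binary.PropositionalEquality using (_≡_; _≢_; refl; sym; ≢-sym)
open import Relation.Nullary.Negation using (¬_)
open import Relation.Unary using (Pred)

record Graph : Set₁ where
  field
    Vertex     : Set
    Adj        : Rel Vertex 0ℓ
    adj-sym    : Symmetric Adj
    adj-irrefl : Irreflexive _≡_ Adj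

open Graph public

K : ℕ → Graph
K n = record
  { Vertex     = Fin n
  ; Adj        = _≢_
  ; adj-sym    = ≢-sym
  ; adj-irrefl = λ x≡y x≢y → x≢y x≡y
  }

infixr 7 _copiesOf_

_copiesOf_ : ℕ → Graph → Graph
n copiesOf G = record
  { Vertex     = Fin n × Vertex G
  ; Adj        = λ (i , x) (j , y) → i ≡ j × Adj G x y
  ; adj-sym    = λ (i≡j , xy) → sym i≡j , adj-sym G xy
  ; adj-irrefl = λ { refl (_ , xx) → adj-irrefl G refl xx }
  }

JoinAdj : (G H : Graph) → Rel (Vertex G ⊎ Vertex H) 0ℓ
JoinAdj G H (inj₁ x) (inj₁ y) = Adj G x y
JoinAdj G H (inj₁ _) (inj₂ _) = ⊤
JoinAdj G H (inj₂ _) (inj₁ _) = ⊤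
JoinAdj G H (inj₂ x) (inj₂ y) = Adj H x y

infixr 6 _∨ᴳ_

_∨ᴳ_ : Graph → Graph → Graph
G ∨ᴳ H = record
  { Vertex     = Vertex G ⊎ Vertex H
  ; Adj        = JoinAdj G H
  ; adj-sym    = λ {x} {y} → symm x y
  ; adj-irrefl = λ { {x} refl → irr x }
  }
  where
  symm : ∀ x y → JoinAdj G H x y → JoinAdj G H y x
  symm (inj₁ _) (inj₁ _) xy = adj-sym G xy
  symm (inj₁ _) (inj₂ _) _  = tt
  symm (inj₂ _) (inj₁ _) _  = tt
  symm (inj₂ _) (inj₂ _) xy = adj-sym H xy

  irr : ∀ x → JoinAdj G H x x → ⊥
  irr (inj₁ _) xx = adj-irrefl G refl xx
  irr (inj₂ _) xx = adj-irrefl H refl xx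

Book : ℕ → Graph
Book n = K 2 ∨ᴳ n copiesOf K 1

-- A map E(G) → {1, …, t}: the adjacency proof is irrelevant and the colour is
-- symmetric in the endpoints, so it depends only on the unordered edge.
record Coloring (t : ℕ) (G : Graph) : Set where
  field
    colour     : (x y : Vertex G) → .(Adj G x y) → Fin t
    colour-sym : ∀ x y (xy : Adj G x y) →
                 colour x y xy ≡ colour y x (adj-sym G xy)

open Coloring public

RainbowTriangle : ∀ {t G} → Coloring t G → Set
RainbowTriangle {G = G} f =
  ∃[ x ] ∃[ y ] ∃[ z ]
  Σ[ xy ∈ Adj G x y ] Σ[ xz ∈ Adj G x z ] Σ[ yz ∈ Adj G y z ]
    colour f x y xy ≢ colour f x z xz ×
    colour f x y xy ≢ colour f y z yz ×
    colour f x z xz ≢ colour f y z yz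

Gallai : ∀ {t G} → Coloring t G → Set
Gallai f = ¬ RainbowTriangle f

-- A (not necessarily induced) subgraph of H isomorphic to G, given by an
-- injective homomorphism from G onto it.
record Copy (G H : Graph) : Set where
  field
    to           : Vertex G → Vertex H
    to-injective : Injective _≡_ _≡_ to
    to-adj       : ∀ {x y} → Adj G x y → Adj H (to x) (to y)

open Copy public

UsesAtMost : ∀ {t G H} → ℕ → Coloring t H → Copy G H → Set
UsesAtMost {t} {G} s f φ =
  Σ[ C ∈ Subset t ] ∣ C ∣ ≤ s ×
    (∀ x y (xy : Adj G x y) → colour f (to φ x) (to φ y) (to-adj φ xy) ∈ C)

GallaiArrows : (t s : ℕ) → Graph → Pred ℕ 0ℓ
GallaiArrows t s G p =
  (f : Coloring t (K p)) → Gallai f → Σ[ φ ∈ Copy G (K p) ] UsesAtMost s f φ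

IsLeast : Pred ℕ 0ℓ → Pred ℕ 0ℓ
IsLeast P p = P p × (∀ q → P q → p ≤ q)

-- gr^t_s(G) = p, as a relation, so that no existence proof is needed to state it.
infix 4 gr^_[_]_≐_

gr^_[_]_≐_ : (t s : ℕ) → Graph → ℕ → Set
gr^ t [ s ] G ≐ p = IsLeast (GallaiArrows t s G) p

{-# OPTIONS --safe #-}

-- For an edge x y and a colour e other than its own, the vertices z for which
-- neither x z nor y z has colour e are the pages of a book avoiding e.  Suppose
-- all these books in a Gallai colouring of K 20 have at most 11 pages.  Counting
-- gives deg e x + deg e y ≥ 7 for every edge x y not coloured e.  By Gallai's
-- theorem some colour is disconnected, and any two of its components are joined
-- by a single colour.  Unless the vertices split into two sides joined by a
-- single colour r, each vertex has three further components around it, two of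
-- them seen in the same colour, and then the components are too large for 20
-- vertices.  If both sides have at least two vertices, the smaller one is
-- 2-coloured of order 9 or 10 with few monochromatic triangles on each edge,
-- and in the larger colour class at a vertex of it a neighbourhood of order 5
-- would be perfectly matched.  If a side is a single vertex, the same dichotomy
-- on the other 19 vertices makes r a cubic graph of odd order.  For the lower
-- bound, one colour joins two graphs derived from Paley graphs.

module Submission where

open import Defs

import Algebra.Properties.CommutativeMonoid.Sum
open import Data.Bool.Base using (Bool; true; false; _∨_; if_then_else_)
open import Data.Empty using (⊥; ⊥-elim)
open import Data.Fin.Base using (Fin; zero; suc; punchIn; inject≤; toℕ)
open import Data.Fin.Patterns using (0F; 1F; 2F)
open import Data.Fin.Properties
  using (_≟_; any?; all?; punchInᵢ≢i; punchIn-injective; inject≤-injective; suc-injective)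
open import Data.Fin.Subset using (Subset; _∈_; _∉_; ∣_∣; ∁; ⁅_⁆)
open import Data.Fin.Subset.Properties using (∣∁p∣≡n∸∣p∣; ∣⁅x⁆∣≡1; x∉p⇒x∈∁p; x≢y⇒x∉⁅y⁆)
open import Data.List.Base using (List; []; _∷_; map; filter; cartesianProduct; allFin)
open import Data.List.Membership.Propositional using () renaming (_∈_ to _∈ˡ_)
open import Data.List.Membership.Propositional.Properties
  using (∈-filter⁺; ∈-cartesianProduct⁺; ∈-allFin)
open import Data.List.Relation.Unary.All as All using (All)
open import Data.List.Relation.Unary.All.Properties using (all-filter)
open import Data.List.Relation.Unary.AllPairs as AllPairs using (AllPairs)
open import Data.List.Relation.Unary.Any using (here; there)
open import Data.Nat.Base
  using (ℕ; zero; suc; pred; _+_; _*_; _∸_; _/_; _%_; ∣_-_∣; _≤_; _<_; _<ᵇ_; _≡ᵇ_; z≤n; s≤s)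
open import Data.Nat.Properties hiding (_≟_; suc-injective)
open import Data.Nat.Tactic.RingSolver using (solve; solve-∀)
open import Data.Product.Base using (Σ-syntax; ∃; ∃₂; _×_; _,_; proj₁; proj₂)
open import Data.Sum.Base using (_⊎_; inj₁; inj₂; [_,_]′)
open import Data.Unit.Base using (tt)
import Data.Vec.Base as Vec
open import Function.Base using (_∘_; id; case_of_)
open import Function.Definitions using (Injective)
open import Level using (0ℓ)
import Relation.Binary.Construct.On as On
open import Relation.Binary.Core using (Rel)
open import Relation.Binary.PropositionalEquality as Eq
  using (_≡_; _≢_; refl; sym; trans; cong; cong₂; subst; ≢-sym; module ≡-Reasoning)
open import Relation.Binary.Structures using (IsEquivalence)
open import Relation.Nullary.Decidable
  using (Dec; yes; no; does; ¬?; _×-dec_; _→-dec_; toWitness; decidable-stable)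
open import Relation.Nullary.Negation using (¬_; contradiction)
open import Relation.Unary using (Pred; Decidable)

-- Counting

module Sum = Algebra.Properties.CommutativeMonoid.Sum +-0-commutativeMonoid

otherColour : (a b : Fin 3) → ∃ λ c → c ≢ a × c ≢ b
otherColour = toWitness
  {a? = all? λ a → all? λ b → any? λ c → ¬? (c ≟ a) ×-dec ¬? (c ≟ b)} _

thirdColour : ∀ (a b c d : Fin 3) → a ≢ b → a ≢ c → b ≢ c → d ≢ a → d ≢ b → d ≡ c
thirdColour = toWitness
  {a? = all? λ a → all? λ b → all? λ c → all? λ d →
    ¬? (a ≟ b) →-dec (¬? (a ≟ c) →-dec (¬? (b ≟ c) →-dec
    (¬? (d ≟ a) →-dec (¬? (d ≟ b) →-dec d ≟ c))))} _

module _ {A : Set} where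
  𝟙 : Dec A → ℕ
  𝟙 a? = if does a? then 1 else 0

  𝟙-yes : (a? : Dec A) → A → 𝟙 a? ≡ 1
  𝟙-yes (yes _) _ = refl
  𝟙-yes (no ¬a) a = contradiction a ¬a

  𝟙-no : (a? : Dec A) → ¬ A → 𝟙 a? ≡ 0
  𝟙-no (yes a) ¬a = contradiction a ¬a
  𝟙-no (no _)  _  = refl

  𝟙≥1 : (a? : Dec A) → A → 1 ≤ 𝟙 a?
  𝟙≥1 a? a = ≤-reflexive (sym (𝟙-yes a? a))

  𝟙-≤ : ∀ {r} (a? : Dec A) → (A → 1 ≤ r) → 𝟙 a? ≤ r
  𝟙-≤ (yes a) h = h a
  𝟙-≤ (no _)  _ = z≤n

  -- Iterated, this shows that a list of sets covers a point: each set may be assumed to fail before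
  -- the next one is examined.
  𝟙-cover : ∀ {k} (a? : Dec A) → (¬ A → 1 ≤ k) → 1 ≤ 𝟙 a? + k
  𝟙-cover (yes _) _ = s≤s z≤n
  𝟙-cover (no ¬a) h = h ¬a

  -- Iterated, this bounds the indicators of disjoint sets: once one of them holds, all later ones
  -- vanish.
  𝟙-exclusive : ∀ {k r} (a? : Dec A) → (A → k ≡ 0) → (A → 1 ≤ r) → k ≤ r → 𝟙 a? + k ≤ r
  𝟙-exclusive (yes a) k≡0 1≤r _   = subst (λ k → suc k ≤ _) (sym (k≡0 a)) (1≤r a)
  𝟙-exclusive (no _)  _   _   k≤r = k≤r

  𝟙-none : ∀ {k} (a? : Dec A) → ¬ A → k ≡ 0 → 𝟙 a? + k ≡ 0
  𝟙-none a? ¬a k≡0 = cong₂ _+_ (𝟙-no a? ¬a) k≡0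

𝟙-cong : ∀ {A B : Set} (a? : Dec A) (b? : Dec B) → (A → B) → (B → A) → 𝟙 a? ≡ 𝟙 b?
𝟙-cong (yes a) b? f _ = sym (𝟙-yes b? (f a))
𝟙-cong (no ¬a) b? _ g = sym (𝟙-no b? (¬a ∘ g))

-- Pointwise form of |A| + |B| ≤ |A ∩ B| + |A ∪ B|, with `p` for the intersection and `q` for the
-- union.
𝟙-both : ∀ {A B : Set} {p q} (a? : Dec A) (b? : Dec B) → (A → B → 1 ≤ p) →
         (A → 1 ≤ q) → (B → 1 ≤ q) → 𝟙 a? + (𝟙 b? + 0) ≤ p + q
𝟙-both (yes a) (yes b) ab _ b′ = +-mono-≤ (ab a b) (b′ b)
𝟙-both (yes a) (no _)  _  a′ _ = ≤-trans (a′ a) (m≤n+m _ _)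
𝟙-both (no _)  (yes b) _  _ b′ = ≤-trans (b′ b) (m≤n+m _ _)
𝟙-both (no _)  (no _)  _  _ _  = z≤n

-- Opaque, so that sums are handled through the laws below; only `paley-bookFree` evaluates them.
opaque
  sum : ∀ {n} → (Fin n → ℕ) → ℕ
  sum = Sum.sum

  sum-cong : ∀ {n} {g h : Fin n → ℕ} → (∀ z → g z ≡ h z) → sum g ≡ sum h
  sum-cong = Sum.sum-cong-≗

  sum-+ : ∀ {n} (g h : Fin n → ℕ) → sum (λ z → g z + h z) ≡ sum g + sum h
  sum-+ = Sum.∑-distrib-+

  sum-suc : ∀ {n} (h : Fin (suc n) → ℕ) → sum h ≡ h zero + sum (h ∘ suc)
  sum-suc h = refl

  sum-punchIn : ∀ {n} (i : Fin (suc n)) (h : Fin (suc n) → ℕ) → sum h ≡ h i + sum (h ∘ punchIn i)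
  sum-punchIn i h = Sum.sum-remove {i = i} h

  sum-mono : ∀ {n} (g h : Fin n → ℕ) → (∀ z → g z ≤ h z) → sum g ≤ sum h
  sum-mono {zero}  g h g≤h = z≤n
  sum-mono {suc n} g h g≤h = +-mono-≤ (g≤h zero) (sum-mono (g ∘ suc) (h ∘ suc) (g≤h ∘ suc))

  sum-const : ∀ n k → sum {n} (λ _ → k) ≡ n * k
  sum-const zero    k = refl
  sum-const (suc n) k = cong (k +_) (sum-const n k)

sum-0 : ∀ {n} (h : Fin n → ℕ) → (∀ z → h z ≡ 0) → sum h ≡ 0
sum-0 {n} h h≡0 = trans (sum-cong h≡0) (trans (sum-const n 0) (*-zeroʳ n))

sum-1 : ∀ n → sum {n} (λ _ → 1) ≡ n
sum-1 n = trans (sum-const n 1) (*-identityʳ n)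

count : ∀ {n} {P : Pred (Fin n) _} → Decidable P → ℕ
count P? = sum λ z → 𝟙 (P? z)

total : ∀ {n} → List (Fin n → ℕ) → Fin n → ℕ
total []       z = 0
total (h ∷ hs) z = h z + total hs z

sums : ∀ {n} → List (Fin n → ℕ) → ℕ
sums []       = 0
sums (h ∷ hs) = sum h + sums hs

sum-total : ∀ {n} (hs : List (Fin n → ℕ)) → sum (total hs) ≡ sums hs
sum-total {n} []   = sum-0 {n} _ λ _ → refl
sum-total (h ∷ hs) = trans (sum-+ h (total hs)) (cong (sum h +_) (sum-total hs))

-- Most counts below pass through here: classifying a single vertex `z` gives the pointwise
-- inequality of indicators, and summing it compares the sizes of the classes.
sums-mono : ∀ {n} (gs hs : List (Fin n → ℕ)) →
            (∀ z → total gs z ≤ total hs z) → sums gs ≤ sums hs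
sums-mono gs hs gs≤hs = begin
  sums gs         ≡⟨ sum-total gs ⟨
  sum (total gs)  ≤⟨ sum-mono _ _ gs≤hs ⟩
  sum (total hs)  ≡⟨ sum-total hs ⟩
  sums hs         ∎
  where open ≤-Reasoning

count-point : ∀ {n} (x : Fin n) → count (_≟ x) ≡ 1
count-point {suc n} zero = trans (sum-suc {n} (λ z → 𝟙 (z ≟ zero)))
  (cong suc (sum-0 {n} (λ z → 𝟙 (suc z ≟ zero)) λ z → refl))
count-point {suc n} (suc x) = trans (sum-suc {n} (λ z → 𝟙 (z ≟ suc x)))
  (trans (sum-cong λ z → 𝟙-cong (suc z ≟ suc x) (z ≟ x) suc-injective (cong suc)) (count-point x))

count-none : ∀ {n} {P : Pred (Fin n) _} (P? : Decidable P) → (∀ z → ¬ P z) → count P? ≡ 0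
count-none P? ¬P = sum-0 _ λ z → 𝟙-no (P? z) (¬P z)

count-witness : ∀ {n} {P : Pred (Fin n) _} (P? : Decidable P) → 1 ≤ count P? → ∃ P
count-witness P? 1≤ with any? P?
... | yes p = p
... | no ¬p = contradiction (subst (1 ≤_) (count-none P? λ z Pz → ¬p (z , Pz)) 1≤) λ ()

count-remove : ∀ {n} {P : Pred (Fin n) _} (P? : Decidable P) {x} → P x →
               count P? ≡ suc (count (λ z → P? z ×-dec ¬? (z ≟ x)))
count-remove P? {x} Px = begin
  count P?                                       ≡⟨ sum-cong split ⟩
  sum (λ z → 𝟙 (z ≟ x) + 𝟙 (rest z))             ≡⟨ sum-+ (λ z → 𝟙 (z ≟ x)) _ ⟩
  count (_≟ x) + count rest                      ≡⟨ cong (_+ count rest) (count-point x) ⟩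
  suc (count rest)                               ∎
  where
  open ≡-Reasoning
  rest = λ z → P? z ×-dec ¬? (z ≟ x)
  split : ∀ z → 𝟙 (P? z) ≡ 𝟙 (z ≟ x) + 𝟙 (rest z)
  split z with z ≟ x | P? z
  ... | yes refl | yes _  = refl
  ... | yes refl | no ¬Px = contradiction Px ¬Px
  ... | no _     | yes _  = refl
  ... | no _     | no _   = refl

choose : ∀ {n} k {P : Pred (Fin n) _} (P? : Decidable P) → k ≤ count P? →
         ∃ λ (g : Fin k → Fin n) → Injective _≡_ _≡_ g × (∀ i → P (g i))
choose zero    P? _ = (λ ()) , (λ { {()} }) , λ ()
choose (suc k) P? k<
  with x , Px ← count-witness P? (≤-trans (s≤s z≤n) k<)
  with g , inj , Pg ← choose k (λ z → P? z ×-dec ¬? (z ≟ x))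
                        (≤-pred (subst (suc k ≤_) (count-remove P? Px) k<))
  = (λ { zero → x ; (suc i) → g i })
  , (λ { {zero}  {zero}  _  → refl
       ; {zero}  {suc j} eq → contradiction (sym eq) (proj₂ (Pg j))
       ; {suc i} {zero}  eq → contradiction eq (proj₂ (Pg i))
       ; {suc i} {suc j} eq → cong suc (inj eq) })
  , λ { zero → Px ; (suc i) → proj₁ (Pg i) }

injection-≤-count : ∀ {n} k {P : Pred (Fin n) _} (P? : Decidable P) (g : Fin k → Fin n) →
                    Injective _≡_ _≡_ g → (∀ i → P (g i)) → k ≤ count P?
injection-≤-count zero    P? g inj Pg = z≤n
injection-≤-count (suc k) P? g inj Pg =
  subst (suc k ≤_) (sym (count-remove P? (Pg zero)))
    (s≤s (injection-≤-count k (λ z → P? z ×-dec ¬? (z ≟ g zero)) (g ∘ suc)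
      (λ eq → suc-injective (inj eq))
      λ i → Pg (suc i) , λ eq → contradiction (inj eq) λ ()))

-- Deleting the index `zero` removes its row and its column, which agree by symmetry, so the total
-- drops by the even number `row + row`.
handshake : ∀ {n} (m : Fin n → Fin n → ℕ) → (∀ x → m x x ≡ 0) → (∀ x y → m x y ≡ m y x) →
            ∃ λ k → sum (λ x → sum (m x)) ≡ k + k
handshake {zero}  m diag symm = 0 , sum-0 _ λ ()
handshake {suc n} m diag symm
  with k , eq ← handshake (λ x y → m (suc x) (suc y)) (diag ∘ suc) (λ x y → symm (suc x) (suc y))
  = row + k , (begin
      sum (λ x → sum (m x))
        ≡⟨ trans (sum-suc _) (cong₂ _+_ (sum-suc (m zero)) (sum-cong λ x → sum-suc (m (suc x)))) ⟩
      m zero zero + row + sum (λ x → m (suc x) zero + sum (m′ x))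
        ≡⟨ cong₂ _+_ (cong (_+ row) (diag zero)) (sum-+ (λ x → m (suc x) zero) _) ⟩
      row + (sum (λ x → m (suc x) zero) + sum (λ x → sum (m′ x)))
        ≡⟨ cong (row +_) (cong₂ _+_ (sum-cong λ x → symm (suc x) zero) eq) ⟩
      row + (row + (k + k))
        ≡⟨ regroup row k ⟩
      row + k + (row + k) ∎)
  where
  open ≡-Reasoning
  row = sum λ y → m zero (suc y)
  m′ = λ x y → m (suc x) (suc y)
  regroup : ∀ a b → a + (a + (b + b)) ≡ a + b + (a + b)
  regroup = solve-∀

-- A certificate for linear arithmetic: the hypotheses are added up to `l ≤ r`, and a ring identity
-- compares this sum with the goal, `k` being the slack.
linear : ∀ {l r a b} k → l ≤ r → a + r + k ≡ b + l → a ≤ b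
linear {l} {r} {a} {b} k l≤r eq = +-cancelʳ-≤ r a b (begin
  a + r      ≤⟨ m≤m+n (a + r) k ⟩
  a + r + k  ≡⟨ eq ⟩
  b + l      ≤⟨ +-monoʳ-≤ b l≤r ⟩
  b + r      ∎)
  where open ≤-Reasoning

infixr 6 _⊞_
_⊞_ : ∀ {a b c d} → a ≤ b → c ≤ d → a + c ≤ b + d
_⊞_ = +-mono-≤

odd≢even : ∀ k j → k + k ≢ suc (j + j)
odd≢even zero    j ()
odd≢even (suc k) j eq rewrite +-suc k k with j
... | suc i rewrite +-suc i i = odd≢even k i (cong (pred ∘ pred) eq)

-- An even number that is at least `2k - 1` is at least `2k`.
halve : ∀ k {d} → suc (pred k + pred k) ≤ d + d → k ≤ d
halve zero    _ = z≤n
halve (suc k) {d} h = ≰⇒> λ d≤k → <⇒≱ h (d≤k ⊞ d≤k)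

-- Gallai colourings

module _ {n : ℕ} where

  -- Union-find: adding an edge gives the class of `a` the label of `b`, so the classes are the
  -- connected components of the edge list.
  label : List (Fin n × Fin n) → Fin n → Fin n
  label []             x = x
  label ((a , b) ∷ es) x with label es x ≟ label es a
  ... | yes _ = label es b
  ... | no _  = label es x

  label-joins : ∀ es {a b} → (a , b) ∈ˡ es → label es a ≡ label es b
  label-joins ((a , b) ∷ es) (here refl) with label es a ≟ label es a | label es b ≟ label es a
  ... | yes _  | yes _ = refl
  ... | yes _  | no _  = refl
  ... | no a≢a | _     = contradiction refl a≢a
  label-joins ((a , b) ∷ es) (there {xs = es} i) = aux (label-joins es i)
    where
    aux : ∀ {x y} → label es x ≡ label es y → label ((a , b) ∷ es) x ≡ label ((a , b) ∷ es) y
    aux {x} {y} eq with label es x ≟ label es a | label es y ≟ label es a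
    ... | yes _  | yes _  = refl
    ... | yes xa | no ¬ya = contradiction (trans (sym eq) xa) ¬ya
    ... | no ¬xa | yes ya = contradiction (trans eq ya) ¬xa
    ... | no _   | no _   = eq

  -- Stands in for induction along paths: a property of pairs that is an equivalence and holds along
  -- each edge holds throughout a component.
  label-finest : ∀ {_~_ : Rel (Fin n) 0ℓ} → IsEquivalence _~_ →
                 ∀ {es} → All (λ (a , b) → a ~ b) es →
                 ∀ {x y} → label es x ≡ label es y → x ~ y
  label-finest eqv All.[] refl = IsEquivalence.refl eqv
  label-finest eqv {(a , b) ∷ es} (a~b All.∷ es~) {x} {y} eq
    with label es x ≟ label es a | label es y ≟ label es a
  ... | yes xa | yes ya = label-finest eqv es~ (trans xa (sym ya))
  ... | yes xa | no _   =
    IsEquivalence.trans eqv (label-finest eqv es~ xa)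
      (IsEquivalence.trans eqv a~b (label-finest eqv es~ eq))
  ... | no _   | yes ya =
    IsEquivalence.trans eqv (label-finest eqv es~ eq)
      (IsEquivalence.sym eqv (IsEquivalence.trans eqv (label-finest eqv es~ ya) a~b))
  ... | no _   | no _   = label-finest eqv es~ eq

-- The diagonal is coloured too, so no proofs of distinctness are carried along and `restrict` works
-- for any map of vertices.
record GallaiColoring (n : ℕ) : Set where
  field
    col        : Fin n → Fin n → Fin 3
    col-sym    : ∀ x y → col x y ≡ col y x
    no-rainbow : ∀ x y z → col x y ≢ col x z → col x y ≢ col y z → col x z ≡ col y z

open GallaiColoring

restrict : ∀ {m n} → (Fin m → Fin n) → GallaiColoring n → GallaiColoring m
restrict g c = record
  { col        = λ x y → col c (g x) (g y)
  ; col-sym    = λ x y → col-sym c (g x) (g y)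
  ; no-rainbow = λ x y z → no-rainbow c (g x) (g y) (g z)
  }

-- The colour `missing` may occur inside the sides; what it lacks is an edge across the cut.
record Disconnection {n} (c : GallaiColoring n) : Set where
  field
    missing  : Fin 3
    side     : Fin n → Fin 2
    uncut    : ∀ x y → col c x y ≡ missing → side x ≡ side y
    proper   : ∃₂ λ u v → side u ≢ side v

record GallaiPartition {n} (c : GallaiColoring n) : Set where
  field
    missing     : Fin 3
    block       : Fin n → Fin n
    avoids      : ∀ {x y} → block x ≢ block y → col c x y ≢ missing
    homogeneous : ∀ {x x′ y} → block x ≡ block x′ → block x ≢ block y → col c x y ≡ col c x′ y
    proper      : ∃₂ λ u v → block u ≢ block v

  otherBlock : ∀ x → ∃ λ y → block x ≢ block y
  otherBlock x with u , v , u≢v ← proper with block x ≟ block u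
  ... | yes xu = v , u≢v ∘ trans (sym xu)
  ... | no ¬xu = u , ¬xu

  sameBlock : ∀ {x p z} → block x ≢ block p → block p ≡ block z → col c x z ≡ col c x p
  sameBlock {x} {p} {z} xp pz = begin
    col c x z ≡⟨ col-sym c x z ⟩
    col c z x ≡⟨ homogeneous (sym pz) (λ zx → xp (sym (trans pz zx))) ⟩
    col c p x ≡⟨ col-sym c p x ⟩
    col c x p ∎
    where open ≡-Reasoning

-- The blocks are the components of the disconnected colour: walking along an
-- edge of that colour cannot change the colour seen from outside the component.
components : ∀ {n} {c : GallaiColoring n} → Disconnection c → GallaiPartition c
components {n} {c} d = record
  { missing     = missing
  ; block       = block
  ; avoids      = λ x≢y xy → x≢y (label-joins edges (edge xy))
  ; homogeneous = λ x≡x′ x≢y → proj₂ (label-finest ~-equiv ~-edges x≡x′) _ x≢y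
  ; proper      = let u , v , u≢v = proper in
                  u , v , λ eq → u≢v (label-finest
                      (On.isEquivalence side Eq.isEquivalence) side-edges eq)
  }
  where
  open Disconnection d
  missing? : (p : Fin n × Fin n) → Dec (col c (proj₁ p) (proj₂ p) ≡ missing)
  missing? (x , y) = col c x y ≟ missing
  pairs = cartesianProduct (allFin n) (allFin n)
  edges = filter missing? pairs
  block = label edges
  edge : ∀ {x y} → col c x y ≡ missing → (x , y) ∈ˡ edges
  edge xy = ∈-filter⁺ missing? (∈-cartesianProduct⁺ (∈-allFin _) (∈-allFin _)) xy
  side-edges : All (λ (x , y) → side x ≡ side y) edges
  side-edges = All.map (λ {(x , y)} → uncut x y) (all-filter missing? pairs)
  -- Equality of blocks is part of the relation because symmetry and transitivity must move the
  -- condition `block x ≢ block y` from one vertex to the other.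
  _~_ : Rel (Fin n) _
  x ~ x′ = block x ≡ block x′ × (∀ y → block x ≢ block y → col c x y ≡ col c x′ y)
  ~-equiv : IsEquivalence _~_
  ~-equiv = record
    { refl  = refl , λ _ _ → refl
    ; sym   = λ (p , h) → sym p , λ y x′≢y → sym (h y (x′≢y ∘ trans (sym p)))
    ; trans = λ (p , h) (q , k) → trans p q ,
                λ y x≢y → trans (h y x≢y) (k y (x≢y ∘ trans p))
    }
  ~-edges : All (λ (x , y) → x ~ y) edges
  ~-edges = All.map
    (λ {(x , x′)} xx′ → let x≡x′ = label-joins edges (edge xx′) in
      x≡x′ , λ y x≢y → no-rainbow′ xx′ (x≢y ∘ label-joins edges ∘ edge)
                                 (x≢y ∘ trans x≡x′ ∘ label-joins edges ∘ edge))
    (all-filter missing? pairs)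
    where
    no-rainbow′ : ∀ {x x′ y} → col c x x′ ≡ missing → col c x y ≢ missing → col c x′ y ≢ missing →
                  col c x y ≡ col c x′ y
    no-rainbow′ p q r = no-rainbow c _ _ _ (λ eq → q (trans (sym eq) p))
        (λ eq → r (trans (sym eq) p))

indicator : ∀ {n} {P : Fin n → Set} → (∀ z → Dec (P z)) → Fin n → Fin 2
indicator P? z = if does (P? z) then 0F else 1F

module _ {n} {P : Fin n → Set} (P? : ∀ z → Dec (P z)) where
  indicator-yes : ∀ {z} → P z → indicator P? z ≡ 0F
  indicator-yes {z} p with P? z
  ... | yes _ = refl
  ... | no ¬p = contradiction p ¬p

  indicator-no : ∀ {z} → ¬ P z → indicator P? z ≡ 1F
  indicator-no {z} ¬p with P? z
  ... | yes p = contradiction p ¬p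
  ... | no _  = refl

  indicator-≢ : ∀ {z w} → P z → ¬ P w → indicator P? z ≢ indicator P? w
  indicator-≢ p ¬q eq with () ← trans (sym (indicator-yes p)) (trans eq (indicator-no ¬q))

  separated : ∀ {x y} → indicator P? x ≢ indicator P? y → (P x × ¬ P y) ⊎ (¬ P x × P y)
  separated {x} {y} x≢y with P? x | P? y
  ... | yes _ | yes _ = contradiction refl x≢y
  ... | yes p | no ¬q = inj₁ (p , ¬q)
  ... | no ¬p | yes q = inj₂ (¬p , q)
  ... | no _  | no _  = contradiction refl x≢y

module _ {n} (c : GallaiColoring n) {P : Fin n → Set} (P? : ∀ z → Dec (P z)) where

  separate : ∀ {u v} → P u → ¬ P v → (e : Fin 3) →
             (∀ x y → P x → ¬ P y → col c x y ≢ e) → Disconnection c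
  separate {u} {v} Pu ¬Pv e sep = record
    { missing = e
    ; side    = indicator P?
    ; uncut   = λ x y xy → decidable-stable (indicator P? x ≟ indicator P? y) λ x≢y →
                  [ (λ (p , ¬q) → sep x y p ¬q xy)
                  , (λ (¬p , q) → sep y x q ¬p (trans (col-sym c y x) xy)) ]′ (separated P? x≢y)
    ; proper  = u , v , indicator-≢ P? Pu ¬Pv
    }

-- Let v = zero be a new vertex.  If v misses the colour e of the partition on
-- some block, or has only colour e, we are done.  Otherwise let v x have a
-- colour r ≠ e.  As v sends e to every block, all colours leaving the block of
-- x, also those to v, lie in {e , r}, so the third colour is disconnected.
module _ {n} (c : GallaiColoring (suc n)) (part : GallaiPartition (restrict suc c)) where
  open GallaiPartition part

  private
    InBlock : Fin n → Fin (suc n) → Set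
    InBlock x zero    = ⊥
    InBlock x (suc z) = block z ≡ block x

    inBlock? : ∀ x z → Dec (InBlock x z)
    inBlock? x zero    = no λ ()
    inBlock? x (suc z) = block z ≟ block x

    Misses Meets : Fin n → Set
    Misses x = ∀ z → block z ≡ block x → col c zero (suc z) ≢ missing
    Meets  x = ∃ λ z → block z ≡ block x × col c zero (suc z) ≡ missing

    module _ {x b} (meets : ∀ y → Meets y) (0x : col c zero (suc x) ≢ missing)
             (b≢m : b ≢ missing) (b≢0x : b ≢ col c zero (suc x)) where

      leaving : ∀ {z y} → block z ≡ block x → block x ≢ block y →
                col c (suc z) (suc y) ≡ col c zero (suc x)
      leaving {z} {y} z∈ y∉ with w , w∈ , wm ← meets y = begin
        col c (suc z) (suc y) ≡⟨ homogeneous z∈ (y∉ ∘ trans (sym z∈)) ⟩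
        col c (suc x) (suc y) ≡⟨ col-sym c _ _ ⟩
        col c (suc y) (suc x) ≡⟨ homogeneous (sym w∈) (≢-sym y∉) ⟩
        -- In the triangle on `zero`, `w` and `x` only the edge from `zero` to `w` has the colour
        -- `missing`, so the other two edges agree.
        col c (suc w) (suc x) ≡⟨ no-rainbow c zero (suc w) (suc x)
                                   (λ eq → 0x (trans (sym eq) wm))
                                   (λ eq → avoids {w} {x} (λ eq′ → y∉ (trans (sym eq′) w∈))
                                       (trans (sym eq) wm)) ⟨
        col c zero (suc x)    ∎
        where open ≡-Reasoning

      avoids-b : ∀ z w → InBlock x z → ¬ InBlock x w → col c z w ≢ b
      avoids-b (suc z) (suc w) z∈ w∉ eq = b≢0x (trans (sym eq) (leaving z∈ (w∉ ∘ sym)))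
      -- If `z` were joined to `zero` in `b`, a vertex `w` of another block with `missing` towards
      -- `zero` would complete a rainbow triangle, as `z w` has the colour of `zero x`.
      avoids-b (suc z) zero    z∈ _  eq
        with y , y∉ ← otherBlock x
        with w , w∈ , wm ← meets y
        = 0x (trans (sym zw) (trans (sym (no-rainbow c zero (suc z) (suc w)
            (λ eq′ → b≢m (trans (sym 0z) (trans eq′ wm)))
            (λ eq′ → b≢0x (trans (sym 0z) (trans eq′ zw))))) wm))
        where
        0z : col c zero (suc z) ≡ b
        0z = trans (col-sym c zero (suc z)) eq
        zw = leaving z∈ (λ eq′ → y∉ (trans eq′ w∈))

  addVertex : Disconnection c
  addVertex with any? {P = Misses} (λ x → all? λ z →
                   (block z ≟ block x) →-dec ¬? (col c zero (suc z) ≟ missing))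
  ... | yes (x , misses) = separate c (inBlock? x) {suc x} {zero} refl (λ ()) missing
    λ { (suc z) zero    z∈ _  → misses z z∈ ∘ trans (col-sym c zero (suc z))
      ; (suc z) (suc w) z∈ w∉ → avoids λ eq → w∉ (trans (sym eq) z∈) }
  ... | no ¬misses with any? (λ x → ¬? (col c zero (suc x) ≟ missing))
  ...   | no allMissing = let e , e≢m , _ = otherColour missing missing in
    separate c (_≟ zero) {zero} {suc (proj₁ proper)} refl (λ ()) e
      λ { zero zero    _ ¬p _  → ¬p refl
        ; zero (suc w) _ _  eq → allMissing (w , λ wm → e≢m (trans (sym eq) wm)) }
  ...   | yes (x , 0x) = let b , b≢m , b≢0x = otherColour missing (col c zero (suc x)) in
    separate c (inBlock? x) {suc x} {zero} refl (λ ()) b (avoids-b meets 0x b≢m b≢0x)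
    where
    meets : ∀ y → Meets y
    meets y = decidable-stable (any? λ z → (block z ≟ block y) ×-dec (col c zero (suc z) ≟ missing))
      λ ¬meets → ¬misses (y , λ z z∈ zm → ¬meets (z , z∈ , zm))

-- Induction on the order, extending the components of the colouring without `zero`. On two vertices
-- every colour but that of the single edge is disconnected.
gallai : ∀ {n} (c : GallaiColoring (suc (suc n))) → Disconnection c
gallai {zero} c = let e , e≢01 , _ = otherColour (col c 0F 1F) (col c 0F 1F) in
  separate c (_≟ 0F) {0F} {1F} refl (λ ()) e
    λ { 0F 0F _ ¬p _ → ¬p refl ; 0F 1F _ _ eq → e≢01 (sym eq) }
gallai {suc n} c = addVertex c (components (gallai (restrict suc c)))

gallaiPartition : ∀ {n} (c : GallaiColoring (suc (suc n))) → GallaiPartition c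
gallaiPartition c = components (gallai c)

-- Two sides joined by one colour, or many blocks

record Bipartition {n} (c : GallaiColoring n) : Set where
  field
    crossing : Fin 3
    side     : Fin n → Fin 2
    crosses  : ∀ {x y} → side x ≢ side y → col c x y ≡ crossing
    proper   : ∃₂ λ u v → side u ≢ side v

module _ {n} {c : GallaiColoring n} (part : GallaiPartition c) where
  open GallaiPartition part

  record ThreeMoreBlocks (y : Fin n) : Set where
    field
      {p q t} : Fin n
      yp      : block y ≢ block p
      yq      : block y ≢ block q
      yt      : block y ≢ block t
      pq      : block p ≢ block q
      pt      : block p ≢ block t
      qt      : block q ≢ block t

  record EqualPair (y : Fin n) : Set where
    field
      {p q} : Fin n
      yp    : block y ≢ block p
      yq    : block y ≢ block q
      pq    : block p ≢ block q
      same  : col c y p ≡ col c y q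

  -- Pigeonhole: `y` sees the three blocks in the two colours other than `missing`.
  equalPair : ∀ {y} → ThreeMoreBlocks y → EqualPair y
  equalPair {y} record { p = p ; q = q ; t = t ; yp = yp ; yq = yq ; yt = yt ; pq = pq ; pt = pt ; qt = qt }
    with col c y p ≟ col c y q | col c y p ≟ col c y t
  ... | yes p=q | _       = record { yp = yp ; yq = yq ; pq = pq ; same = p=q }
  ... | no _    | yes p=t = record { yp = yp ; yq = yt ; pq = pt ; same = p=t }
  ... | no p≠q  | no p≠t  = record { yp = yq ; yq = yt ; pq = qt ; same = sym
    (thirdColour _ _ _ _ (≢-sym (avoids yp)) (≢-sym (avoids yq)) p≠q (avoids yt) (≢-sym p≠t)) }

  -- The sides are the block of `y` and its complement; homogeneity extends the colour `r` from `y`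
  -- to its whole block.
  star : ∀ y r → (∀ z → block y ≢ block z → col c y z ≡ r) → Bipartition c
  star y r yz = record
    { crossing = r
    ; side     = indicator inBlock
    ; crosses  = λ {x} {z} x≢z →
        [ (λ (x∈ , z∉) → leaves x∈ z∉)
        , (λ (x∉ , z∈) → trans (col-sym c x z) (leaves z∈ x∉)) ]′ (separated inBlock x≢z)
    ; proper   = let z , z∉ = otherBlock y in y , z , indicator-≢ inBlock refl (z∉ ∘ sym)
    }
    where
    inBlock = λ z → block z ≟ block y
    leaves : ∀ {x z} → block x ≡ block y → block z ≢ block y → col c x z ≡ r
    leaves x∈ z∉ = trans (homogeneous x∈ (λ eq → z∉ (trans (sym eq) x∈))) (yz _ (≢-sym z∉))

  -- With two blocks the cut between them is homogeneous. With three, the three colours between them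
  -- avoid `missing`, so two coincide, and the block where these two meet is the centre of a `star`.
  dichotomy : ∀ y → Bipartition c ⊎ ThreeMoreBlocks y
  dichotomy y with p , yp ← otherBlock y
    with any? (λ q → ¬? (block y ≟ block q) ×-dec ¬? (block p ≟ block q))
  ... | no ¬q = inj₁ (star y (col c y p) λ z yz →
    sameBlock yp (decidable-stable (_ ≟ _) λ pz → ¬q (z , yz , pz)))
  ... | yes (q , yq , pq)
    with any? (λ t → ¬? (block y ≟ block t) ×-dec ¬? (block p ≟ block t) ×-dec ¬?
        (block q ≟ block t))
  ...   | yes (t , yt , pt , qt) =
    inj₂ (record { yp = yp ; yq = yq ; yt = yt ; pq = pq ; pt = pt ; qt = qt })
  ...   | no ¬t with col c y p ≟ col c y q | col c p y ≟ col c p q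
  ...     | yes p=q | _       = inj₁ (star y (col c y p) λ z yz → case block p ≟ block z of λ where
    (yes pz) → sameBlock yp pz
    (no ¬pz) → trans (sameBlock yq (decidable-stable (_ ≟ _) λ qz → ¬t (z , yz , ¬pz , qz)))
        (sym p=q))
  ...     | no _    | yes y=q = inj₁ (star p (col c p y) λ z pz → case block y ≟ block z of λ where
    (yes yz) → sameBlock (≢-sym yp) yz
    (no ¬yz) → trans (sameBlock pq (decidable-stable (_ ≟ _) λ qz → ¬t (z , ¬yz , pz , qz)))
        (sym y=q))
  -- Neither `y` nor `p` is such a centre, so `p q` and `y q` share a colour and `q` is one.
  ...     | no p≠q  | no y≠q  = inj₁ (star q (col c q y) λ z qz → case block y ≟ block z of λ where
    (yes yz) → sameBlock (≢-sym yq) yz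
    (no ¬yz) → trans (sameBlock (≢-sym pq) (decidable-stable (_ ≟ _) λ pz → ¬t
        (z , ¬yz , pz , qz))) qp=qy)
    where
    qp=qy : col c q p ≡ col c q y
    qp=qy = trans (trans (col-sym c q p)
      (thirdColour _ _ _ _ (≢-sym (avoids yp)) (≢-sym (avoids yq)) p≠q (avoids pq)
        (λ eq → y≠q (trans (col-sym c p y) (sym eq)))))
      (col-sym c y q)

-- Degrees and pages

module _ {n} (c : GallaiColoring n) where

  -- The inequality excludes the diagonal, which carries a colour as well.
  Link : Fin 3 → Fin n → Fin n → Set
  Link e x z = z ≢ x × col c x z ≡ e

  link? : ∀ e x z → Dec (Link e x z)
  link? e x z = ¬? (z ≟ x) ×-dec (col c x z ≟ e)

  Page : Fin 3 → Fin n → Fin n → Fin n → Set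
  Page e x y z = (z ≢ x × col c x z ≢ e) × (z ≢ y × col c y z ≢ e)

  page? : ∀ e x y z → Dec (Page e x y z)
  page? e x y z = (¬? (z ≟ x) ×-dec ¬? (col c x z ≟ e)) ×-dec (¬? (z ≟ y) ×-dec ¬? (col c y z ≟ e))

  deg : Fin 3 → Fin n → ℕ
  deg e x = count (link? e x)

  common? : ∀ e x y z → Dec (Link e x z × Link e y z)
  common? e x y z = link? e x z ×-dec link? e y z

  codeg : Fin 3 → Fin n → Fin n → ℕ
  codeg e x y = count (common? e x y)

  pages : Fin 3 → Fin n → Fin n → ℕ
  pages e x y = count (page? e x y)

  BookFree : Set
  BookFree = ∀ e x y → x ≢ y → col c x y ≢ e → pages e x y ≤ 11

  link-sym : ∀ {e x z} → Link e x z → Link e z x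
  link-sym (z≢x , xz) = ≢-sym z≢x , trans (col-sym c _ _) xz

  isPage : ∀ {e x y z} → z ≢ x → z ≢ y → ¬ Link e x z → ¬ Link e y z → Page e x y z
  isPage z≢x z≢y ¬xz ¬yz = (z≢x , λ xz → ¬xz (z≢x , xz)) , (z≢y , λ yz → ¬yz (z≢y , yz))

  -- A vertex off the spine that is an `e`-neighbour of neither end is a page.
  page-cover : ∀ e x y z → 1 ≤ 𝟙 (z ≟ x) + (𝟙 (z ≟ y) +
      (𝟙 (link? e x z) + (𝟙 (link? e y z) + (𝟙 (page? e x y z) + 0))))
  page-cover e x y z = 𝟙-cover (z ≟ x) λ z≢x → 𝟙-cover (z ≟ y) λ z≢y →
    𝟙-cover (link? e x z) λ ¬xz → 𝟙-cover (link? e y z) λ ¬yz →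
    𝟙-cover (page? e x y z) λ ¬page → contradiction (isPage z≢x z≢y ¬xz ¬yz) ¬page

  n≤degrees+pages : ∀ e x y → n ≤ 2 + (deg e x + (deg e y + pages e x y))
  n≤degrees+pages e x y = arith _ _ _ (deg e x) (deg e y) (pages e x y)
    (sums-mono ((λ _ → 1) ∷ [])
      ((λ z → 𝟙 (z ≟ x)) ∷ (λ z → 𝟙 (z ≟ y)) ∷ (λ z → 𝟙 (link? e x z)) ∷
       (λ z → 𝟙 (link? e y z)) ∷ (λ z → 𝟙 (page? e x y z)) ∷ [])
      (page-cover e x y))
    (≤-reflexive (sym (sum-1 n))) (≤-reflexive (count-point x)) (≤-reflexive (count-point y))
    where
    arith : ∀ i px py a b t → i + 0 ≤ px + (py + (a + (b + (t + 0)))) → n ≤ i → px ≤ 1 → py ≤ 1 →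
            n ≤ 2 + (a + (b + t))
    arith i px py a b t h i≥n px≤1 py≤1 =
      linear 0 (h ⊞ i≥n ⊞ px≤1 ⊞ py≤1) (solve (n ∷ i ∷ px ∷ py ∷ a ∷ b ∷ t ∷ []))

  degrees-≤ : ∀ {a b d} x → a ≢ b → a ≢ d → b ≢ d → suc (deg a x + deg b x + deg d x) ≤ n
  degrees-≤ {a} {b} {d} x a≢b a≢d b≢d = arith _ _ (deg a x) (deg b x) (deg d x)
    (sums-mono
      ((λ z → 𝟙 (z ≟ x)) ∷ (λ z → 𝟙 (link? a x z)) ∷ (λ z → 𝟙 (link? b x z)) ∷
          (λ z → 𝟙 (link? d x z)) ∷ [])
      ((λ _ → 1) ∷ [])
      λ z → 𝟙-exclusive (z ≟ x)
              (λ z≡x → 𝟙-none (link? a x z) (λ l → proj₁ l z≡x)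
                       (𝟙-none (link? b x z) (λ l → proj₁ l z≡x)
                       (𝟙-none (link? d x z) (λ l → proj₁ l z≡x) refl))) (λ _ → s≤s z≤n)
           (𝟙-exclusive (link? a x z)
              (λ (_ , xz) → 𝟙-none (link? b x z) (λ l → a≢b (trans (sym xz) (proj₂ l)))
                            (𝟙-none (link? d x z) (λ l → a≢d (trans (sym xz) (proj₂ l))) refl))
                                (λ _ → s≤s z≤n)
           (𝟙-exclusive (link? b x z)
              (λ (_ , xz) → 𝟙-none (link? d x z) (λ l → b≢d (trans (sym xz) (proj₂ l))) refl)
                  (λ _ → s≤s z≤n)
           (𝟙-exclusive (link? d x z) (λ _ → refl) (λ _ → s≤s z≤n) z≤n))))
    (≤-reflexive (sum-1 n)) (≤-reflexive (sym (count-point x)))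
    where
    arith : ∀ i px a b d → px + (a + (b + (d + 0))) ≤ i + 0 → i ≤ n → 1 ≤ px → suc (a + b + d) ≤ n
    arith i px a b d h i≤n px≥1 = linear 0 (h ⊞ i≤n ⊞ px≥1) (solve (n ∷ i ∷ px ∷ a ∷ b ∷ d ∷ []))

module _ {n m} (s : Fin n → Fin m) where

  size : Fin n → ℕ
  size x = count (λ z → s z ≟ s x)

  sizes-≤ : ∀ {xs} → AllPairs (λ x y → s x ≢ s y) xs → sums (map (λ x z → 𝟙 (s z ≟ s x)) xs) ≤ n
  sizes-≤ {xs} distinct = ≤-trans
    (sums-mono (map (λ x z → 𝟙 (s z ≟ s x)) xs) ((λ _ → 1) ∷ []) (λ z → atMostOne z distinct))
    (≤-reflexive (trans (+-identityʳ _) (sum-1 n)))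
    where
    none : ∀ z x {ys} → s z ≡ s x → All (λ y → s x ≢ s y) ys → total
        (map (λ x z → 𝟙 (s z ≟ s x)) ys) z ≡ 0
    none z x zx All.[]             = refl
    none z x zx (x≢y All.∷ x≢ys) = 𝟙-none (s z ≟ s _) (λ zy → x≢y (trans (sym zx) zy))
        (none z x zx x≢ys)
    atMostOne : ∀ z {ys} → AllPairs (λ x y → s x ≢ s y) ys → total
        (map (λ x z → 𝟙 (s z ≟ s x)) ys) z ≤ 1
    atMostOne z AllPairs.[] = z≤n
    atMostOne z (x≢ys AllPairs.∷ ys!) =
      𝟙-exclusive (s z ≟ s _) (λ zx → none z _ zx x≢ys) (λ _ → s≤s z≤n) (atMostOne z ys!)

  -- Strict, since `x` lies in its own class but is not its own neighbour.
  deg<size : ∀ (c : GallaiColoring n) {e x} → (∀ z → col c x z ≡ e → s z ≡ s x) → deg c e x < size x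
  deg<size c {e} {x} inside = arith _ (deg c e x) (size x)
    (sums-mono ((λ z → 𝟙 (z ≟ x)) ∷ (λ z → 𝟙 (link? c e x z)) ∷ []) ((λ z → 𝟙 (s z ≟ s x)) ∷ [])
      λ z → 𝟙-exclusive (z ≟ x)
              (λ z≡x → 𝟙-none (link? c e x z) (λ l → proj₁ l z≡x) refl)
              (λ z≡x → 𝟙-cover (s z ≟ s x) (λ ¬zx → contradiction (cong s z≡x) ¬zx))
            (𝟙-exclusive (link? c e x z) (λ _ → refl)
              (λ (_ , xz) → 𝟙-cover (s z ≟ s x) (λ ¬zx → contradiction (inside z xz) ¬zx)) z≤n))
    (≤-reflexive (sym (count-point x)))
    where
    arith : ∀ px g σ → px + (g + 0) ≤ σ + 0 → 1 ≤ px → suc g ≤ σ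
    arith px g σ h px≥1 = linear 0 (h ⊞ px≥1) (solve (px ∷ g ∷ σ ∷ []))

module _ {n} {c : GallaiColoring n} (part : GallaiPartition c) where
  open GallaiPartition part

  deg<block : ∀ x → deg c missing x < size block x
  deg<block x = deg<size block c λ z xz →
    decidable-stable (block z ≟ block x) λ zx → avoids (≢-sym zx) xz

  equalPair-deg : ∀ {y} (d : EqualPair part y) → let open EqualPair d in
                  size block p + size block q ≤ deg c (col c y p) y
  equalPair-deg {y} d = arith (size block p) (size block q) (deg c (col c y p) y)
    (sums-mono ((λ z → 𝟙 (block z ≟ block p)) ∷ (λ z → 𝟙 (block z ≟ block q)) ∷ [])
      ((λ z → 𝟙 (link? c (col c y p) y z)) ∷ [])
      λ z → 𝟙-exclusive (block z ≟ block p)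
              (λ zp → 𝟙-none (block z ≟ block q) (λ zq → pq (trans (sym zp) zq)) refl)
              (λ zp → link yp zp refl)
            (𝟙-exclusive (block z ≟ block q) (λ _ → refl) (λ zq → link yq zq (sym same)) z≤n))
    where
    open EqualPair d
    link : ∀ {w z a} → block y ≢ block w → block z ≡ block w → col c y w ≡ a →
           1 ≤ 𝟙 (link? c a y z) + 0
    arith : ∀ a b d → a + (b + 0) ≤ d + 0 → a + b ≤ d
    arith a b d h = linear 0 h (solve (a ∷ b ∷ d ∷ []))
    link yw zw a = 𝟙-cover (link? c _ y _) λ ¬l → contradiction
      ((λ { refl → yw zw }) , trans (sameBlock yw (sym zw)) a) ¬l

  -- The book on `x x′` avoiding the third colour `b` has as pages both blocks of the pair and all
  -- common `missing`-neighbours of `x` and `x′`. Both `missing`-neighbourhoods lie in the block of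
  -- `x`, so inclusion-exclusion bounds their overlap from below.
  equalPair-pages : ∀ {x x′ b} (d : EqualPair part x) → let open EqualPair d in
                    Link c missing x x′ → b ≢ missing → b ≢ col c x p →
                    size block p + (size block q + (deg c missing x + (deg c missing x′ + 0)))
                      ≤ pages c b x x′ + (size block x + 0)
  equalPair-pages {x} {x′} {b} d (x′≢x , xx′) b≢e b≢xp =
    sums-mono ((λ z → 𝟙 (block z ≟ block p)) ∷ (λ z → 𝟙 (block z ≟ block q)) ∷
               (λ z → 𝟙 (link? c missing x z)) ∷ (λ z → 𝟙 (link? c missing x′ z)) ∷ [])
              ((λ z → 𝟙 (page? c b x x′ z)) ∷ (λ z → 𝟙 (block z ≟ block x)) ∷ [])
      λ z → 𝟙-exclusive (block z ≟ block p)
              (λ zp → 𝟙-none (block z ≟ block q) (λ zq → pq (trans (sym zp) zq))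
                      (𝟙-none (link? c missing x z) (λ l → yp (trans (linked l) zp))
                      (𝟙-none (link? c missing x′ z) (λ l → yp (trans (linked′ l) zp)) refl)))
              (λ zp → outsidePage yp zp (≢-sym b≢xp))
            (𝟙-exclusive (block z ≟ block q)
              (λ zq → (𝟙-none (link? c missing x z) (λ l → yq (trans (linked l) zq))
                      (𝟙-none (link? c missing x′ z) (λ l → yq (trans (linked′ l) zq)) refl)))
              (λ zq → outsidePage yq zq (λ eq → b≢xp (sym (trans same eq))))
            (insidePages z))
    where
    open EqualPair d
    linked : ∀ {y z} → Link c missing y z → block y ≡ block z
    linked (_ , yz) = decidable-stable (_ ≟ _) λ y≢z → avoids y≢z yz
    linked′ : ∀ {z} → Link c missing x′ z → block x ≡ block z
    linked′ l = trans (linked (x′≢x , xx′)) (linked l)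
    outsidePage : ∀ {w z} → block x ≢ block w → block z ≡ block w → col c x w ≢ b →
                  1 ≤ 𝟙 (page? c b x x′ z) + (𝟙 (block z ≟ block x) + 0)
    outsidePage {w} {z} xw zw ≢b = 𝟙-cover (page? c b x x′ z) λ ¬page → contradiction
      ( ((λ { refl → xw zw }) , λ eq → ≢b (trans (sym (sameBlock xw (sym zw))) eq))
      , ((λ { refl → xw (trans xx′-block zw) }) ,
         λ eq → ≢b (trans (sym (trans (sym (homogeneous xx′-block λ eq′ → xw (trans eq′ zw)))
             (sameBlock xw (sym zw)))) eq)) )
      ¬page
      where xx′-block = linked (x′≢x , xx′)
    insidePages : ∀ z → 𝟙 (link? c missing x z) + (𝟙 (link? c missing x′ z) + 0)
                  ≤ 𝟙 (page? c b x x′ z) + (𝟙 (block z ≟ block x) + 0)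
    insidePages z = 𝟙-both (link? c missing x z) (link? c missing x′ z)
      (λ l l′ → 𝟙≥1 (page? c b x x′ z) ( (proj₁ l , λ eq → b≢e (trans (sym eq) (proj₂ l)))
                                      , (proj₁ l′ , λ eq → b≢e (trans (sym eq) (proj₂ l′)))))
      (λ l → 𝟙-cover (block z ≟ block x) (contradiction (sym (linked l))))
      (λ l′ → 𝟙-cover (block z ≟ block x) (contradiction (sym (linked′ l′))))

Fin2-other : ∀ (a b d : Fin 2) → a ≢ b → d ≢ a → d ≡ b
Fin2-other 0F 0F _  a≢b _   = contradiction refl a≢b
Fin2-other 1F 1F _  a≢b _   = contradiction refl a≢b
Fin2-other 0F 1F 0F _   d≢a = contradiction refl d≢a
Fin2-other 0F 1F 1F _   _   = refl
Fin2-other 1F 0F 0F _   _   = refl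
Fin2-other 1F 0F 1F _   d≢a = contradiction refl d≢a

module _ {n} (s : Fin n → Fin 2) where

  twoSides : ∀ {u v} → s u ≢ s v → n ≤ size s u + size s v
  twoSides {u} {v} u≢v = arith _ (size s u) (size s v)
    (sums-mono ((λ _ → 1) ∷ []) ((λ z → 𝟙 (s z ≟ s u)) ∷ (λ z → 𝟙 (s z ≟ s v)) ∷ [])
      λ z → 𝟙-cover (s z ≟ s u) λ zu → 𝟙-cover (s z ≟ s v) λ zv →
        contradiction (Fin2-other _ _ _ u≢v zu) zv)
    (≤-reflexive (sym (sum-1 n)))
    where
    arith : ∀ i a b → i + 0 ≤ a + (b + 0) → n ≤ i → n ≤ a + b
    arith i a b h h′ = linear 0 (h ⊞ h′) (solve (n ∷ i ∷ a ∷ b ∷ []))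

module _ {n m} (s : Fin n → Fin m) (c : GallaiColoring n) where

  side≤deg : ∀ {x y e} → s x ≢ s y → (∀ z → s z ≡ s y → col c x z ≡ e) → size s y ≤ deg c e x
  side≤deg {x} {y} {e} x≢y toSide = sum-mono (λ z → 𝟙 (s z ≟ s y)) (λ z → 𝟙 (link? c e x z))
    λ z → 𝟙-≤ (s z ≟ s y) λ zy → 𝟙≥1 (link? c e x z) ((λ { refl → x≢y zy }) , toSide z zy)

  degrees<size : ∀ {x e d} → e ≢ d → (∀ z → col c x z ≡ e → s z ≡ s x) →
                 (∀ z → col c x z ≡ d → s z ≡ s x) → suc (deg c e x + deg c d x) ≤ size s x
  degrees<size {x} {e} {d} e≢d in₁ in₂ = arith _ (deg c e x) (deg c d x) (size s x)
    (sums-mono ((λ z → 𝟙 (z ≟ x)) ∷ (λ z → 𝟙 (link? c e x z)) ∷ (λ z → 𝟙 (link? c d x z)) ∷ [])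
               ((λ z → 𝟙 (s z ≟ s x)) ∷ [])
      λ z → 𝟙-exclusive (z ≟ x)
              (λ z≡x → 𝟙-none (link? c e x z) (λ l → proj₁ l z≡x)
                       (𝟙-none (link? c d x z) (λ l → proj₁ l z≡x) refl))
              (λ z≡x → inside z (cong s z≡x))
            (𝟙-exclusive (link? c e x z)
              (λ (_ , xz) → 𝟙-none (link? c d x z) (λ l → e≢d (trans (sym xz) (proj₂ l))) refl)
              (λ (_ , xz) → inside z (in₁ z xz))
            (𝟙-exclusive (link? c d x z) (λ _ → refl) (λ (_ , xz) → inside z (in₂ z xz)) z≤n)))
    (≤-reflexive (sym (count-point x)))
    where
    inside : ∀ z → s z ≡ s x → 1 ≤ 𝟙 (s z ≟ s x) + 0
    inside z zx = 𝟙-cover (s z ≟ s x) (contradiction zx)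
    arith : ∀ px a b σ → px + (a + (b + 0)) ≤ σ + 0 → 1 ≤ px → suc (a + b) ≤ σ
    arith px a b σ h h′ = linear 0 (h ⊞ h′) (solve (px ∷ a ∷ b ∷ σ ∷ []))

-- The vertices other than the single vertex of a side

module Nineteen {m} (m≡17 : m ≡ 17) (c : GallaiColoring (suc (suc m))) (r : Fin 3)
                (dense : ∀ {e} x → e ≢ r → 7 ≤ deg c e x)
                (cross : ∀ {x y} → x ≢ y → col c x y ≢ r → 6 ≤ deg c r x + deg c r y) where

  private
    n≤19 : suc (suc m) ≤ 19
    n≤19 = ≤-reflexive (cong (2 +_) m≡17)
    19≤n : 19 ≤ suc (suc m)
    19≤n = ≤-reflexive (cong (2 +_) (sym m≡17))
    a b : Fin 3
    a = proj₁ (otherColour r r)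
    b = proj₁ (otherColour r a)
    a≢r : a ≢ r
    a≢r = proj₁ (proj₂ (otherColour r r))
    b≢r : b ≢ r
    b≢r = proj₁ (proj₂ (otherColour r a))
    b≢a : b ≢ a
    b≢a = proj₂ (proj₂ (otherColour r a))

  -- The two other colours take at least 14 of the 18 edges at `x`.
  deg-r≤4 : ∀ x → deg c r x ≤ 4
  deg-r≤4 x = arith (deg c r x) (deg c a x) (deg c b x)
    (≤-trans (degrees-≤ c x (≢-sym a≢r) (≢-sym b≢r) (≢-sym b≢a)) n≤19) (dense x a≢r) (dense x b≢r)
    where
    arith : ∀ r a b → suc (r + a + b) ≤ 19 → 7 ≤ a → 7 ≤ b → r ≤ 4
    arith r a b h ha hb = linear 0 (h ⊞ ha ⊞ hb) (solve (r ∷ a ∷ b ∷ []))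

  -- If the crossing colour is `r`, each side lies in an `r`-neighbourhood and has order at most 4.
  -- Otherwise a vertex has, inside its side, at least 7 edges of the third colour and at least
  -- `6 - 4` of colour `r`, so both sides have order at least 10.
  ¬bipartition : ¬ Bipartition c
  ¬bipartition bip = contradiction (case crossing ≟ r of λ where
      (yes k≡r) → tooFew (size side u) (size side v) 19≤ (small (≢-sym u≢v) k≡r) (small u≢v k≡r)
      (no k≢r)  → tooMany (size side u) (size side v) ≤19 (large u≢v k≢r) (large (≢-sym u≢v) k≢r))
    λ ()
    where
    open Bipartition bip
    u = proj₁ proper
    v = proj₁ (proj₂ proper)
    u≢v = proj₂ (proj₂ proper)
    tooFew : ∀ α β → 19 ≤ α + β → α ≤ 4 → β ≤ 4 → 1 ≤ 0
    tooFew α β h ha hb = linear 10 (h ⊞ ha ⊞ hb) (solve (α ∷ β ∷ []))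
    tooMany : ∀ α β → α + (β + 0) ≤ 19 → 10 ≤ α → 10 ≤ β → 1 ≤ 0
    tooMany α β h ha hb = linear 0 (h ⊞ ha ⊞ hb) (solve (α ∷ β ∷ []))
    ≤19 = ≤-trans (sizes-≤ side ((u≢v All.∷ All.[]) AllPairs.∷ All.[] AllPairs.∷ AllPairs.[])) n≤19
    19≤ = ≤-trans 19≤n (twoSides side u≢v)
    small : ∀ {x y} → side x ≢ side y → crossing ≡ r → size side y ≤ 4
    small {x} {y} x≢y refl = ≤-trans (side≤deg side c x≢y
        (λ z zy → crosses (λ xz → x≢y (trans xz zy)))) (deg-r≤4 x)
    large : ∀ {x y} → side x ≢ side y → crossing ≢ r → 10 ≤ size side x
    large {x} {y} x≢y k≢r = let e , e≢k , e≢r = otherColour crossing r in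
      arith (deg c e x) (deg c r x) (deg c r y) (size side x)
        (degrees<size side c e≢r (λ z xz → inside z xz e≢k) (λ z xz → inside z xz (≢-sym k≢r)))
        (dense x e≢r) (cross (x≢y ∘ cong side) (k≢r ∘ trans (sym (crosses x≢y)))) (deg-r≤4 y)
      where
      inside : ∀ z {d} → col c x z ≡ d → d ≢ crossing → side z ≡ side x
      inside z xz d≢k = decidable-stable (side z ≟ side x) λ zx →
        d≢k (trans (sym xz) (crosses (≢-sym zx)))
      arith : ∀ e r r′ σ → suc (e + r) ≤ σ → 7 ≤ e → 6 ≤ r + r′ → r′ ≤ 4 → 10 ≤ σ
      arith e r r′ σ h he hr hr′ = linear 0 (h ⊞ he ⊞ hr ⊞ hr′) (solve (e ∷ r ∷ r′ ∷ σ ∷ []))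

  module _ (part : GallaiPartition c) (more : ∀ y → ThreeMoreBlocks part y) where
    open GallaiPartition part

    -- Otherwise `dense` makes every block of order at least 8, and three of them exceed 19.
    missing≡r : missing ≡ r
    missing≡r = decidable-stable (missing ≟ r) λ m≢r → contradiction
      (arith (size block 0F) (size block p) (size block q)
        (≤-trans (sizes-≤ block ((yp All.∷ yq All.∷ All.[]) AllPairs.∷
            (pq All.∷ All.[]) AllPairs.∷ All.[] AllPairs.∷ AllPairs.[])) n≤19)
        (big 0F m≢r) (big p m≢r) (big q m≢r))
      λ ()
      where
      open ThreeMoreBlocks (more 0F)
      big : ∀ x → missing ≢ r → 8 ≤ size block x
      big x m≢r = ≤-trans (s≤s (dense x m≢r)) (deg<block part x)
      arith : ∀ α β γ → α + (β + (γ + 0)) ≤ 19 → 8 ≤ α → 8 ≤ β → 8 ≤ γ → 1 ≤ 0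
      arith α β γ h ha hb hg = linear 4 (h ⊞ ha ⊞ hb ⊞ hg) (solve (α ∷ β ∷ γ ∷ []))

    cross′ : ∀ {x y} → block x ≢ block y → 6 ≤ deg c r x + deg c r y
    cross′ x≢y = cross (x≢y ∘ cong block) (λ xy → avoids x≢y (trans xy (sym missing≡r)))

    deg<block′ : ∀ x → deg c r x < size block x
    deg<block′ x = subst (λ e → deg c e x < size block x) missing≡r (deg<block part x)

    -- The two blocks that `x` sees in the colour `k` have together at least `6 + 2` vertices, and
    -- the third colour takes 7 more edges, which leaves 3 of the 18.
    deg-r≤3 : ∀ x → deg c r x ≤ 3
    deg-r≤3 x = let d , d≢r , d≢k = otherColour r k in
      arith (deg c r x) (deg c k x) (deg c d x) (size block p) (size block q) (deg c r p)
          (deg c r q)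
        (≤-trans (degrees-≤ c x (≢-sym k≢r) (≢-sym d≢r) (≢-sym d≢k)) n≤19) (dense x d≢r)
        (equalPair-deg part (equalPair part (more x)))
        (deg<block′ p) (deg<block′ q) (cross′ pq)
      where
      open EqualPair (equalPair part (more x))
      k = col c x p
      k≢r : k ≢ r
      k≢r k≡r = avoids yp (trans k≡r (sym missing≡r))
      arith : ∀ r k d σ τ g h → suc (r + k + d) ≤ 19 → 7 ≤ d → σ + τ ≤ k → suc g ≤ σ → suc h ≤ τ →
              6 ≤ g + h → r ≤ 3
      arith r k d σ τ g h h₁ h₂ h₃ h₄ h₅ h₆ =
        linear 0 (h₁ ⊞ h₂ ⊞ h₃ ⊞ h₄ ⊞ h₅ ⊞ h₆) (solve (r ∷ k ∷ d ∷ σ ∷ τ ∷ g ∷ h ∷ []))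

    -- For `p` in another block the two degrees add up to at least 6, and neither exceeds 3.
    deg-r≡3 : ∀ x → deg c r x ≡ 3
    deg-r≡3 x = ≤-antisym (deg-r≤3 x) (arith (deg c r x) (deg c r p) (cross′ yp) (deg-r≤3 p))
      where
      open ThreeMoreBlocks (more x)
      arith : ∀ g h → 6 ≤ g + h → h ≤ 3 → 3 ≤ g
      arith g h h₁ h₂ = linear 0 (h₁ ⊞ h₂) (solve (g ∷ h ∷ []))

    ¬more : ⊥
    ¬more =
      let k , eq = handshake (λ x z → 𝟙 (link? c r x z))
                     (λ x → 𝟙-no (link? c r x x) (λ l → proj₁ l refl))
                     (λ x y → 𝟙-cong (link? c r x y) (link? c r y x) (link-sym c) (link-sym c))
      in odd k (trans (sym eq) (trans (sum-cong deg-r≡3)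
          (trans (sum-const (suc (suc m)) 3) (cong (λ m → (2 + m) * 3) m≡17))))
      where
      -- The degree sum is `19 * 3 = 57 = 2 * 28 + 1`.
      odd : ∀ k → k + k ≢ 57
      odd k = odd≢even k 28

  impossible : ⊥
  impossible = ¬more part λ y → [ ⊥-elim ∘ ¬bipartition , id ]′ (dichotomy part y)
    where part = gallaiPartition c

-- Colourings of K 20 without books

module Twenty {m} (m≡17 : m ≡ 17) (c : GallaiColoring (suc (suc (suc m)))) (free : BookFree c) where

  private
    n : ℕ
    n = suc (suc (suc m))
    n≤20 : n ≤ 20
    n≤20 = ≤-reflexive (cong (3 +_) m≡17)
    20≤n : 20 ≤ n
    20≤n = ≤-reflexive (cong (3 +_) (sym m≡17))

  cross : ∀ {e x y} → x ≢ y → col c x y ≢ e → 7 ≤ deg c e x + deg c e y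
  cross {e} {x} {y} x≢y xy = arith (deg c e x) (deg c e y) (pages c e x y)
    (≤-trans 20≤n (n≤degrees+pages c e x y)) (free e x y x≢y xy)
    where
    arith : ∀ a b t → 20 ≤ 2 + (a + (b + t)) → t ≤ 11 → 7 ≤ a + b
    arith a b t h h′ = linear 0 (h ⊞ h′) (solve (a ∷ b ∷ t ∷ []))

  module _ (part : GallaiPartition c) (more : ∀ y → ThreeMoreBlocks part y) where
    open GallaiPartition part

    blockCross : ∀ {x y} → block x ≢ block y → 7 ≤ deg c missing x + deg c missing y
    blockCross x≢y = cross (x≢y ∘ cong block) (avoids x≢y)

    -- Apply `equalPair-pages` to an edge `x x′` of colour `missing`: the two blocks contribute at
    -- least `7 + 2` and the two degrees at least `4 + 4`, of which the pages absorb at most 11.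
    6≤size : ∀ x → (∀ z → block x ≡ block z → 4 ≤ deg c missing z) → 6 ≤ size block x
    6≤size x dense =
      let x′ , x′≢x , xx′ = count-witness (link? c missing x) (≤-trans (s≤s z≤n) (dense x refl))
          b , b≢m , b≢xp  = otherColour missing (col c x p)
      in arith (size block x) (size block p) (size block q) (deg c missing x) (deg c missing x′)
              (deg c missing p) (deg c missing q) (pages c b x x′)
          (equalPair-pages part (equalPair part (more x)) (x′≢x , xx′) b≢m b≢xp)
          (free b x x′ (≢-sym x′≢x) (λ eq → b≢m (trans (sym eq) xx′)))
          (deg<block part p) (deg<block part q) (blockCross pq) (dense x refl)
          (dense x′ (decidable-stable (_ ≟ _) λ x≢x′ → avoids x≢x′ xx′))
      where
      open EqualPair (equalPair part (more x))
      arith : ∀ β σ τ g g′ d d′ t → σ + (τ + (g + (g′ + 0))) ≤ t + (β + 0) → t ≤ 11 →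
              suc d ≤ σ → suc d′ ≤ τ → 7 ≤ d + d′ → 4 ≤ g → 4 ≤ g′ → 6 ≤ β
      arith β σ τ g g′ d d′ t h₁ h₂ h₃ h₄ h₅ h₆ h₇ = linear 0 (h₁ ⊞ h₂ ⊞ h₃ ⊞ h₄ ⊞ h₅ ⊞ h₆ ⊞ h₇)
        (solve (β ∷ σ ∷ τ ∷ g ∷ g′ ∷ d ∷ d′ ∷ t ∷ []))

    -- Vertices of different blocks cannot both have `missing`-degree below 4, so a vertex of such
    -- small degree, if there is one, serves as `x`.
    sparse : ∃ λ x → ∀ z → block x ≢ block z → 4 ≤ deg c missing z
    sparse with any? (λ x → deg c missing x <? 4)
    ... | yes (x , x<4) = x , λ z x≢z → arith (deg c missing x) (deg c missing z) x<4
        (blockCross x≢z)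
      where
      arith : ∀ a b → suc a ≤ 4 → 7 ≤ a + b → 4 ≤ b
      arith a b h h′ = linear 0 (h ⊞ h′) (solve (a ∷ b ∷ []))
    ... | no ¬sparse = 0F , λ z _ → ≮⇒≥ λ z<4 → ¬sparse (z , z<4)

    -- Around the `x` of `sparse`, the blocks of `q` and `t` have order at least 6 each, and those
    -- of `x` and `p` together at least `7 + 2`; this makes 21 vertices.
    ¬more : ⊥
    ¬more = tooMany (proj₁ sparse) (proj₂ sparse) (more (proj₁ sparse))
      where
      tooMany : ∀ x → (∀ z → block x ≢ block z → 4 ≤ deg c missing z) → ThreeMoreBlocks part x → ⊥
      tooMany x dense b = contradiction
        (arith (size block x) (size block p) (size block q) (size block t) (deg c missing x)
            (deg c missing p)
          (≤-trans (sizes-≤ block ((yp All.∷ yq All.∷ yt All.∷ All.[]) AllPairs.∷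
              (pq All.∷ pt All.∷ All.[]) AllPairs.∷
                                   (qt All.∷ All.[]) AllPairs.∷ All.[] AllPairs.∷ AllPairs.[])) n≤20)
          (deg<block part x) (deg<block part p) (blockCross yp)
          (6≤size q λ z qz → dense z λ xz → yq (trans xz (sym qz)))
          (6≤size t λ z tz → dense z λ xz → yt (trans xz (sym tz))))
        λ ()
        where
        open ThreeMoreBlocks b
        arith : ∀ σ α β γ g h → σ + (α + (β + (γ + 0))) ≤ 20 → suc g ≤ σ → suc h ≤ α → 7 ≤ g + h →
                6 ≤ β → 6 ≤ γ → 1 ≤ 0
        arith σ α β γ g h h₁ h₂ h₃ h₄ h₅ h₆ =
          linear 0 (h₁ ⊞ h₂ ⊞ h₃ ⊞ h₄ ⊞ h₅ ⊞ h₆) (solve (σ ∷ α ∷ β ∷ γ ∷ g ∷ h ∷ []))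

  module _ (bip : Bipartition c) where
    open Bipartition bip renaming (crossing to r)

    -- On the spine `x x′` the book avoiding `e` has as pages the whole opposite side, joined in
    -- `r`, and the common `k`-neighbours, which lie on the side of the spine because `k` is not
    -- `r`.
    other+codeg≤11 : ∀ {x x′ y k e} → side x ≡ side x′ → side x ≢ side y → x ≢ x′ →
                     col c x x′ ≢ e → e ≢ r → k ≢ e → k ≢ r → size side y + codeg c k x x′ ≤ 11
    other+codeg≤11 {x} {x′} {y} {k} {e} xx x≢y x≢x′ xx′≢e e≢r k≢e k≢r =
      arith (size side y) (codeg c k x x′) (pages c e x x′)
        (sums-mono ((λ z → 𝟙 (side z ≟ side y)) ∷ (λ z → 𝟙 (common? c k x x′ z)) ∷ [])
                   ((λ z → 𝟙 (page? c e x x′ z)) ∷ [])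
          λ z → 𝟙-exclusive (side z ≟ side y)
                  (λ zy → 𝟙-none (common? c k x x′ z)
                      (λ (l , _) → k≢r (trans (sym (proj₂ l)) (crossy refl zy))) refl)
                  (λ zy → isPage′ ( ((λ { refl → x≢y zy }) , λ eq → e≢r
                      (trans (sym eq) (crossy refl zy)))
                                  , ((λ { refl → x≢y (trans xx zy) }) , λ eq → e≢r
                                      (trans (sym eq) (crossy (sym xx) zy)))))
                (𝟙-exclusive (common? c k x x′ z) (λ _ → refl)
                  (λ ((z≢x , xz) , (z≢x′ , x′z)) → isPage′
                    ((z≢x , λ eq → k≢e (trans (sym xz) eq)) ,
                        (z≢x′ , λ eq → k≢e (trans (sym x′z) eq)))) z≤n))
        (free e x x′ x≢x′ xx′≢e)
      where
      crossy : ∀ {w z} → side w ≡ side x → side z ≡ side y → col c w z ≡ r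
      crossy wx zy = crosses λ wz → x≢y (trans (sym wx) (trans wz zy))
      isPage′ : ∀ {z} → Page c e x x′ z → 1 ≤ 𝟙 (page? c e x x′ z) + 0
      isPage′ {z} pg = 𝟙-cover (page? c e x x′ z) (contradiction pg)
      arith : ∀ σ d t → σ + (d + 0) ≤ t + 0 → t ≤ 11 → σ + d ≤ 11
      arith σ d t h h′ = linear 0 (h ⊞ h′) (solve (σ ∷ d ∷ t ∷ []))

    other≤11 : ∀ {x x′ y} → side x ≡ side x′ → side x ≢ side y → x ≢ x′ → size side y ≤ 11
    other≤11 {x} {x′} xx x≢y x≢x′ =
      let e , e≢xx′ , e≢r = otherColour (col c x x′) r
          k , k≢e , k≢r   = otherColour e r
      in ≤-trans (m≤m+n _ _) (other+codeg≤11 xx x≢y x≢x′ (≢-sym e≢xx′) e≢r k≢e k≢r)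

    -- The books avoiding `e` and `k` share the spine. Every vertex off it is a page of one of them,
    -- as otherwise its edges to the spine have the colours `e` and `k` and close a rainbow
    -- triangle; vertices opposite are pages of both. Hence `size side y + 18 ≤ 22`.
    other≤4 : ∀ {x x′ y} → side x ≡ side x′ → side x ≢ side y → x ≢ x′ → col c x x′ ≡ r →
        size side y ≤ 4
    other≤4 {x} {x′} {y} xx x≢y x≢x′ xx′≡r =
      let e , e≢r , _   = otherColour r r
          k , k≢r , k≢e = otherColour r e
      in arith _ _ _ (size side y) (pages c e x x′) (pages c k x x′)
          (sums-mono ((λ z → 𝟙 (side z ≟ side y)) ∷ (λ _ → 1) ∷ [])
             ((λ z → 𝟙 (page? c e x x′ z)) ∷ (λ z → 𝟙 (page? c k x x′ z)) ∷ (λ z → 𝟙 (z ≟ x)) ∷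
                 (λ z → 𝟙 (z ≟ x′)) ∷ [])
             (pointwise e≢r k≢r k≢e))
          (≤-trans 20≤n (≤-reflexive (sym (sum-1 n)))) (≤-reflexive (count-point x))
              (≤-reflexive (count-point x′))
          (free e x x′ x≢x′ (λ eq → e≢r (trans (sym eq) xx′≡r)))
          (free k x x′ x≢x′ (λ eq → k≢r (trans (sym eq) xx′≡r)))
      where
      arith : ∀ i px px′ σ t t′ → σ + (i + 0) ≤ t + (t′ + (px + (px′ + 0))) → 20 ≤ i → px ≤ 1 →
          px′ ≤ 1 →
              t ≤ 11 → t′ ≤ 11 → σ ≤ 4
      arith i px px′ σ t t′ h₁ h₂ h₃ h₄ h₅ h₆ =
        linear 0 (h₁ ⊞ h₂ ⊞ h₃ ⊞ h₄ ⊞ h₅ ⊞ h₆) (solve (i ∷ px ∷ px′ ∷ σ ∷ t ∷ t′ ∷ []))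
      pointwise : ∀ {e k} → e ≢ r → k ≢ r → k ≢ e → ∀ z → 𝟙 (side z ≟ side y) + (1 + 0)
                  ≤ 𝟙 (page? c e x x′ z) + (𝟙 (page? c k x x′ z) + (𝟙 (z ≟ x) + (𝟙 (z ≟ x′) + 0)))
      pointwise {e} {k} e≢r k≢r k≢e z with side z ≟ side y
      ... | yes zy = 𝟙≥1 (page? c e x x′ z) (pageAcross e≢r) ⊞ 𝟙-cover (page? c k x x′ z)
          (contradiction (pageAcross k≢r))
        where
        pageAcross : ∀ {e} → e ≢ r → Page c e x x′ z
        pageAcross e≢r =
            ((λ { refl → x≢y zy }) , λ eq → e≢r (trans (sym eq) (crosses λ xz → x≢y (trans xz zy))))
          , ((λ { refl → x≢y (trans xx zy) }) , λ eq → e≢r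
              (trans (sym eq) (crosses λ xz → x≢y (trans xx (trans xz zy)))))
      ... | no _ =
        𝟙-cover (page? c e x x′ z) λ ¬pe → 𝟙-cover (page? c k x x′ z) λ ¬pk →
        𝟙-cover (z ≟ x) λ z≢x → 𝟙-cover (z ≟ x′) λ z≢x′ → ⊥-elim (neither ¬pe ¬pk z≢x z≢x′)
        where
        same : col c x z ≢ r → col c x′ z ≢ r → col c x z ≡ col c x′ z
        same xz x′z = no-rainbow c x x′ z (λ eq → xz (trans (sym eq) xx′≡r))
            (λ eq → x′z (trans (sym eq) xx′≡r))
        neither : ¬ Page c e x x′ z → ¬ Page c k x x′ z → z ≢ x → z ≢ x′ → ⊥
        neither ¬pe ¬pk z≢x z≢x′ with col c x z ≟ e | col c x′ z ≟ e
        ... | no ¬xe | no ¬x′e = ¬pe ((z≢x , ¬xe) , (z≢x′ , ¬x′e))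
        ... | yes xe | _       = ¬pk ((z≢x , λ xk → k≢e (trans (sym xk) xe)) ,
          (z≢x′ , λ x′k → k≢e (trans (sym x′k)
              (trans (sym (same (λ q → e≢r (trans (sym xe) q)) (λ q → k≢r (trans (sym x′k) q)))) xe))))
        ... | no _   | yes x′e = ¬pk ((z≢x ,
          λ xk → k≢e (trans (sym xk) (trans (same (λ q → k≢r (trans (sym xk) q))
              (λ q → e≢r (trans (sym x′e) q))) x′e))) ,
          (z≢x′ , λ x′k → k≢e (trans (sym x′k) x′e)))

    module SmallSide {u v} (u≢v : side u ≢ side v) (u≤10 : size side u ≤ 10)
        (v≤11 : size side v ≤ 11) where

      private
        20≤u+v : 20 ≤ size side u + size side v
        20≤u+v = ≤-trans 20≤n (twoSides side u≢v)

      -- An edge of colour `r` inside would bound the other side by 4, leaving at most 14 vertices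
      -- in all.
      inside≢r : ∀ {y z} → side y ≡ side u → side z ≡ side u → y ≢ z → col c y z ≢ r
      inside≢r {y} {z} yu zu y≢z yz = contradiction
        (arith (size side u) (size side v) 20≤u+v u≤10
          (other≤4 (trans yu (sym zu)) (λ yv → u≢v (trans (sym yu) yv)) y≢z yz)) λ ()
        where
        arith : ∀ α β → 20 ≤ α + β → α ≤ 10 → β ≤ 4 → 1 ≤ 0
        arith α β h₁ h₂ h₃ = linear 5 (h₁ ⊞ h₂ ⊞ h₃) (solve (α ∷ β ∷ []))

      -- Counting forces the k-neighbourhood N of u to have order 5 and the colour k
      -- to be a perfect matching on it, against the handshake lemma.
      module _ {k e} (k≢r : k ≢ r) (e≢r : e ≢ r) (k≢e : k ≢ e)
               (many : size side u ≤ suc (deg c k u + deg c k u)) where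

        N : Fin n → Set
        N = Link c k u

        inSide : ∀ {y} → N y → side y ≡ side u
        inSide (_ , uy) = decidable-stable (_ ≟ _) λ y≢u → k≢r
            (trans (sym uy) (crosses (≢-sym y≢u)))

        matched≤ : ∀ {y} → N y → size side v + codeg c k u y ≤ 11
        matched≤ {y} (y≢u , uy) = other+codeg≤11 (sym (inSide (y≢u , uy))) u≢v (≢-sym y≢u)
          (λ eq → k≢e (trans (sym uy) eq)) e≢r k≢e k≢r

        Far : Fin n → Fin n → Set
        Far y z = N z × z ≢ y × col c y z ≢ k

        far? : ∀ y z → Dec (Far y z)
        far? y z = link? c k u z ×-dec ¬? (z ≟ y) ×-dec ¬? (col c y z ≟ k)

        far-colour : ∀ {y z} → N y → Far y z → col c y z ≡ e
        far-colour Ny (Nz , z≢y , yz) = thirdColour r k e _ (≢-sym k≢r) (≢-sym e≢r) k≢e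
          (inside≢r (inSide Ny) (inSide Nz) (≢-sym z≢y)) yz

        deg≤far : ∀ y → deg c k u ≤ suc (codeg c k u y + count (far? y))
        deg≤far y = arith _ (deg c k u) (codeg c k u y) (count (far? y))
          (sums-mono ((λ z → 𝟙 (link? c k u z)) ∷ [])
            ((λ z → 𝟙 (z ≟ y)) ∷ (λ z → 𝟙 (common? c k u y z)) ∷ (λ z → 𝟙 (far? y z)) ∷ [])
            λ z → 𝟙-exclusive (link? c k u z) (λ _ → refl)
              (λ Nz → 𝟙-cover (z ≟ y) λ z≢y → 𝟙-cover (common? c k u y z) λ ¬cz → 𝟙-cover
                  (far? y z) λ ¬far →
                contradiction (Nz , z≢y , λ yz → ¬cz (Nz , z≢y , yz)) ¬far) z≤n)
          (≤-reflexive (count-point y))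
          where
          arith : ∀ p d a w → d + 0 ≤ p + (a + (w + 0)) → p ≤ 1 → d ≤ suc (a + w)
          arith p d a w h h′ = linear 0 (h ⊞ h′) (solve (p ∷ d ∷ a ∷ w ∷ []))

        -- A vertex of `N` other than `y` and `y′` that has colour `k` to neither of them has colour
        -- `e` to both.
        deg≤common : ∀ {y y′} → N y → Far y y′ →
                     deg c k u ≤ 2 + (codeg c k u y + codeg c k u y′ + codeg c e y y′)
        deg≤common {y} {y′} Ny far@(Ny′ , y′≢y , ¬yy′) =
          arith _ _ (deg c k u) (codeg c k u y) (codeg c k u y′) (codeg c e y y′)
            (sums-mono ((λ z → 𝟙 (link? c k u z)) ∷ [])
              ((λ z → 𝟙 (z ≟ y)) ∷ (λ z → 𝟙 (z ≟ y′)) ∷ (λ z → 𝟙 (common? c k u y z)) ∷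
               (λ z → 𝟙 (common? c k u y′ z)) ∷ (λ z → 𝟙 (common? c e y y′ z)) ∷ [])
              λ z → 𝟙-exclusive (link? c k u z) (λ _ → refl)
                (λ Nz → 𝟙-cover (z ≟ y) λ z≢y → 𝟙-cover (z ≟ y′) λ z≢y′ →
                  𝟙-cover (common? c k u y z) λ ¬c → 𝟙-cover (common? c k u y′ z) λ ¬c′ →
                  𝟙-cover (common? c e y y′ z) λ ¬e → contradiction
                    ( (z≢y , far-colour Ny (Nz , z≢y , λ yz → ¬c (Nz , z≢y , yz)))
                    , (z≢y′ , far-colour Ny′ (Nz , z≢y′ , λ yz → ¬c′ (Nz , z≢y′ , yz)))) ¬e) z≤n)
            (≤-reflexive (count-point y)) (≤-reflexive (count-point y′))
          where
          arith : ∀ p p′ d a a′ b → d + 0 ≤ p + (p′ + (a + (a′ + (b + 0)))) → p ≤ 1 → p′ ≤ 1 →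
                  d ≤ 2 + (a + a′ + b)
          arith p p′ d a a′ b h h′ h″ = linear 0 (h ⊞ h′ ⊞ h″)
              (solve (p ∷ p′ ∷ d ∷ a ∷ a′ ∷ b ∷ []))

        4≤deg : 4 ≤ deg c k u
        4≤deg = halve 4 (arith (size side u) (size side v) (deg c k u) 20≤u+v v≤11 many)
          where
          arith : ∀ α β d → 20 ≤ α + β → β ≤ 11 → α ≤ suc (d + d) → 7 ≤ d + d
          arith α β d h₁ h₂ h₃ = linear 1 (h₁ ⊞ h₂ ⊞ h₃) (solve (α ∷ β ∷ d ∷ []))

        -- The other side has at least 10 vertices, so `y` has at most one `k`-neighbour in `N`,
        -- which has order at least 4.
        farWitness : ∀ {y} → N y → ∃ (Far y)
        farWitness {y} Ny = count-witness (far? y)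
          (arith (size side u) (size side v) (deg c k u) (codeg c k u y) (count (far? y))
            20≤u+v u≤10 (matched≤ Ny) 4≤deg (deg≤far y))
          where
          arith : ∀ α β d a w → 20 ≤ α + β → α ≤ 10 → β + a ≤ 11 → 4 ≤ d → d ≤ suc (a + w) → 1 ≤ w
          arith α β d a w h₁ h₂ h₃ h₄ h₅ =
            linear 1 (h₁ ⊞ h₂ ⊞ h₃ ⊞ h₄ ⊞ h₅) (solve (α ∷ β ∷ d ∷ a ∷ w ∷ []))

        -- For `y′` far from `y`, each of the spines `u y`, `u y′` and `y y′` has at most
        -- `11 - size side v` common neighbours in its own colour. By `deg≤common` these must
        -- account for all but two vertices of `N`.
        matching : ∀ {y} → N y → codeg c k u y ≡ 1 × deg c k u ≡ 5
        matching {y} Ny =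
          let y′ , far@(Ny′ , y′≢y , ¬yy′) = farWitness Ny in
          bounds (size side u) (size side v) (deg c k u) (codeg c k u y) (codeg c k u y′)
              (codeg c e y y′)
              20≤u+v u≤10 many 4≤deg (matched≤ Ny) (matched≤ Ny′)
              (other+codeg≤11 (trans (inSide Ny) (sym (inSide Ny′)))
                  (λ yv → u≢v (trans (sym (inSide Ny)) yv))
                (≢-sym y′≢y) ¬yy′ k≢r (≢-sym k≢e) e≢r)
              (deg≤common Ny far)
          where
          bounds : ∀ α β d a a′ b → 20 ≤ α + β → α ≤ 10 → α ≤ suc (d + d) → 4 ≤ d → β + a ≤ 11 →
              β + a′ ≤ 11 →
                   β + b ≤ 11 → d ≤ 2 + (a + a′ + b) → a ≡ 1 × d ≡ 5
          bounds α β d a a′ b h₁ h₂ h₃ h₄ h₅ h₆ h₇ h₈ =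
            ≤-antisym (rest≤ 10≤β h₅) 1≤a , ≤-antisym d≤5 5≤d
            where
            10≤β : 10 ≤ β
            10≤β = linear 0 (h₁ ⊞ h₂) (solve (α ∷ β ∷ []))
            rest≤ : ∀ {i j x} → i ≤ β → β + x ≤ i + j → x ≤ j
            rest≤ {i} {j} {x} h h′ = linear 0 (h ⊞ h′) (solve (i ∷ j ∷ x ∷ β ∷ []))
            sum≤ : ∀ {j} → a ≤ j → a′ ≤ j → b ≤ j → d ≤ 2 + (j + j + j)
            sum≤ p p′ q = ≤-trans h₈ (s≤s (s≤s ((p ⊞ p′) ⊞ q)))
            d≤5 : d ≤ 5
            d≤5 = sum≤ (rest≤ 10≤β h₅) (rest≤ 10≤β h₆) (rest≤ 10≤β h₇)
            -- With `11 ≤ β` all three codegrees vanish and `d ≤ 2`.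
            β≤10 : β ≤ 10
            β≤10 = ≮⇒≥ λ 11≤β → contradiction
              (≤-trans h₄ (sum≤ (rest≤ 11≤β h₅) (rest≤ 11≤β h₆) (rest≤ 11≤β h₇)))
                  λ { (s≤s (s≤s ())) }
            -- Now `α` is at least 10, so `9 ≤ d + d`.
            5≤d : 5 ≤ d
            5≤d = halve 5 (linear 0 (h₁ ⊞ h₃ ⊞ β≤10) (solve (α ∷ β ∷ d ∷ [])))
            1≤a : 1 ≤ a
            1≤a = linear 0 (5≤d ⊞ h₈ ⊞ rest≤ 10≤β h₆ ⊞ rest≤ 10≤β h₇) (solve (a ∷ a′ ∷ b ∷ d ∷ []))

        matchedPair? : ∀ y z → Dec (N y × N z × Link c k y z)
        matchedPair? y z = link? c k u y ×-dec link? c k u z ×-dec link? c k y z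

        swapPair : ∀ {y z} → N y × N z × Link c k y z → N z × N y × Link c k z y
        swapPair (Ny , Nz , l) = Nz , Ny , link-sym c l

        -- Each vertex of `N` has exactly one partner, so the pairs, counted in both orders, number
        -- `deg c k u`, which is the odd number 5.
        matchedPairs : ∀ y → count (matchedPair? y) ≡ 𝟙 (link? c k u y)
        matchedPairs y = case link? c k u y of λ where
          (yes Ny) → trans (sum-cong λ z → 𝟙-cong (matchedPair? y z) (common? c k u y z) proj₂
              (Ny ,_))
                       (trans (proj₁ (matching Ny)) (sym (𝟙-yes (link? c k u y) Ny)))
          (no ¬Ny) → trans (count-none (matchedPair? y) λ z (Ny , _) → ¬Ny Ny)
              (sym (𝟙-no (link? c k u y) ¬Ny))

        ¬many : ⊥
        ¬many =
          let y₀ , Ny₀ = count-witness (link? c k u) (≤-trans (s≤s z≤n) 4≤deg)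
              j  , eq  = handshake (λ y z → 𝟙 (matchedPair? y z))
                           (λ y → 𝟙-no (matchedPair? y y) λ (_ , _ , l) → proj₁ l refl)
                           (λ y z → 𝟙-cong (matchedPair? y z) (matchedPair? z y) swapPair swapPair)
          in odd≢even j 2 (trans (sym eq) (trans (sum-cong matchedPairs) (proj₂ (matching Ny₀))))

      -- Only two colours remain for the edges from `u` inside its side; the more frequent one
      -- satisfies `many`.
      ¬small : ⊥
      ¬small =
        let a , a≢r , _   = otherColour r r
            b , b≢r , b≢a = otherColour r a
        in [ (λ a≤b → ¬many b≢r a≢r b≢a (arith (size side u) (deg c a u) (deg c b u)
            (cover a≢r b≢r b≢a) a≤b))
          , (λ b≤a → ¬many a≢r b≢r (≢-sym b≢a)
              (arith′ (size side u) (deg c a u) (deg c b u) (cover a≢r b≢r b≢a) b≤a)) ]′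
          (≤-total (deg c a u) (deg c b u))
        where
        cover : ∀ {a b} → a ≢ r → b ≢ r → b ≢ a → size side u ≤ suc (deg c a u + deg c b u)
        cover {a} {b} a≢r b≢r b≢a = arith₁ _ (size side u) (deg c a u) (deg c b u)
          (sums-mono ((λ z → 𝟙 (side z ≟ side u)) ∷ [])
            ((λ z → 𝟙 (z ≟ u)) ∷ (λ z → 𝟙 (link? c a u z)) ∷ (λ z → 𝟙 (link? c b u z)) ∷ [])
            λ z → 𝟙-exclusive (side z ≟ side u) (λ _ → refl)
              (λ zu → 𝟙-cover (z ≟ u) λ z≢u → 𝟙-cover (link? c a u z) λ ¬a → 𝟙-cover
                  (link? c b u z) λ ¬b →
                contradiction (z≢u , thirdColour r a b _ (≢-sym a≢r) (≢-sym b≢r) (≢-sym b≢a)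
                  (inside≢r refl zu (≢-sym z≢u)) (λ uz → ¬a (z≢u , uz))) ¬b) z≤n)
          (≤-reflexive (count-point u))
          where
          arith₁ : ∀ p σ a b → σ + 0 ≤ p + (a + (b + 0)) → p ≤ 1 → σ ≤ suc (a + b)
          arith₁ p σ a b h h′ = linear 0 (h ⊞ h′) (solve (p ∷ σ ∷ a ∷ b ∷ []))
        arith : ∀ σ a b → σ ≤ suc (a + b) → a ≤ b → σ ≤ suc (b + b)
        arith σ a b h h′ = linear 0 (h ⊞ h′) (solve (σ ∷ a ∷ b ∷ []))
        arith′ : ∀ σ a b → σ ≤ suc (a + b) → b ≤ a → σ ≤ suc (a + a)
        arith′ σ a b h h′ = linear 0 (h ⊞ h′) (solve (σ ∷ a ∷ b ∷ []))

    module _ {u v} (u≢v : side u ≢ side v) (alone : ∀ z → side z ≡ side u → z ≡ u) where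

      private
        û : Fin (suc (suc m)) → Fin n
        û = punchIn u
        c′ = restrict û c

      to-u : ∀ x → col c (û x) u ≡ r
      to-u x = crosses λ xu → punchInᵢ≢i u x (alone _ xu)

      deg-delete : ∀ e x → deg c e (û x) ≡ 𝟙 (link? c e (û x) u) + deg c′ e x
      deg-delete e x = trans (sum-punchIn u (λ z → 𝟙 (link? c e (û x) z)))
        (cong (𝟙 (link? c e (û x) u) +_) (sum-cong λ z → 𝟙-cong (link? c e (û x) (û z))
            (link? c′ e x z)
          (λ (z≢x , xz) → z≢x ∘ cong û , xz) (λ (z≢x , xz) → z≢x ∘ punchIn-injective u z x , xz)))

      -- All edges at `u` have colour `r`, so in the bound `cross` for the edge to `u` the whole 7
      -- falls on the other end, and deleting `u` costs it nothing.
      dense′ : ∀ {e} x → e ≢ r → 7 ≤ deg c′ e x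
      dense′ {e} x e≢r = arith _ _ (deg c e (û x)) (deg c e u)
        (cross (punchInᵢ≢i u x) (λ eq → e≢r (trans (sym eq) (to-u x))))
        (≤-reflexive (deg-delete e x))
        (≤-reflexive (𝟙-no (link? c e (û x) u) λ (_ , xu) → e≢r (trans (sym xu) (to-u x))))
        (≤-reflexive (count-none (link? c e u) λ z (z≢u , uz) → e≢r
            (trans (sym uz) (crosses λ uz → z≢u (alone z (sym uz))))))
        where
        arith : ∀ i d′ d g → 7 ≤ d + g → d ≤ i + d′ → i ≤ 0 → g ≤ 0 → 7 ≤ d′
        arith i d′ d g h₁ h₂ h₃ h₄ = linear 0 (h₁ ⊞ h₂ ⊞ h₃ ⊞ h₄) (solve (i ∷ d′ ∷ d ∷ g ∷ []))

      -- One better than deleting u from cross: u is an r-neighbour of both ends.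
      cross′ : ∀ {x y} → x ≢ y → col c′ x y ≢ r → 6 ≤ deg c′ r x + deg c′ r y
      cross′ {x} {y} x≢y xy = arith _ _ _ _ _ _ (deg c r (û x)) (deg c r (û y))
          (pages c r (û x) (û y)) (deg c′ r x) (deg c′ r y)
        (sums-mono ((λ z → 𝟙 (z ≟ u)) ∷ (λ _ → 1) ∷ [])
          ((λ z → 𝟙 (z ≟ û x)) ∷ (λ z → 𝟙 (z ≟ û y)) ∷ (λ z → 𝟙 (link? c r (û x) z)) ∷
           (λ z → 𝟙 (link? c r (û y) z)) ∷ (λ z → 𝟙 (page? c r (û x) (û y) z)) ∷ [])
          pointwise)
        (≤-trans 20≤n (≤-reflexive (sym (sum-1 n)))) (≤-reflexive (sym (count-point u)))
        (≤-reflexive (count-point (û x))) (≤-reflexive (count-point (û y)))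
        (free r (û x) (û y) (x≢y ∘ punchIn-injective u x y) xy)
        (≤-reflexive (deg-delete r x)) (≤-reflexive (deg-delete r y))
        (𝟙-≤ (link? c r (û x) u) λ _ → s≤s z≤n) (𝟙-≤ (link? c r (û y) u) λ _ → s≤s z≤n)
        where
        link-u : ∀ x → Link c r (û x) u
        link-u x = ≢-sym (punchInᵢ≢i u x) , to-u x
        pointwise : ∀ z → 𝟙 (z ≟ u) + (1 + 0) ≤ 𝟙 (z ≟ û x) + (𝟙 (z ≟ û y) +
                    (𝟙 (link? c r (û x) z) +
                        (𝟙 (link? c r (û y) z) + (𝟙 (page? c r (û x) (û y) z) + 0))))
        pointwise z with z ≟ u
        ... | no _     = page-cover c r (û x) (û y) z
        ... | yes refl = ≤-trans (𝟙≥1 (link? c r (û x) u) (link-u x) ⊞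
            𝟙-cover (link? c r (û y) u) (contradiction (link-u y)))
                (≤-trans (m≤n+m _ (𝟙 (u ≟ û y))) (m≤n+m _ (𝟙 (u ≟ û x))))
        arith : ∀ i p px py ix iy a b t a′ b′ →
                p + (i + 0) ≤ px + (py + (a + (b + (t + 0)))) → 20 ≤ i → 1 ≤ p → px ≤ 1 →
                    py ≤ 1 → t ≤ 11 →
                a ≤ ix + a′ → b ≤ iy + b′ → ix ≤ 1 → iy ≤ 1 → 6 ≤ a′ + b′
        arith i p px py ix iy a b t a′ b′ h₁ h₂ h₃ h₄ h₅ h₆ h₇ h₈ h₉ h₀ =
          linear 0 (h₁ ⊞ h₂ ⊞ h₃ ⊞ h₄ ⊞ h₅ ⊞ h₆ ⊞ h₇ ⊞ h₈ ⊞ h₉ ⊞ h₀)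
            (solve (i ∷ p ∷ px ∷ py ∷ ix ∷ iy ∷ a ∷ b ∷ t ∷ a′ ∷ b′ ∷ []))

      ¬alone : ⊥
      ¬alone = Nineteen.impossible m≡17 c′ r dense′ cross′

    -- A second vertex on the side of `u` gives a spine there; a single vertex is excluded by
    -- `¬alone`.
    size≤11 : ∀ {u v} → side u ≢ side v → size side v ≤ 11
    size≤11 {u} {v} u≢v with any? (λ z → (side z ≟ side u) ×-dec ¬? (z ≟ u))
    ... | yes (z , zu , z≢u) = other≤11 (sym zu) u≢v (≢-sym z≢u)
    ... | no ¬z = ⊥-elim (¬alone u≢v λ z zu → decidable-stable (z ≟ u) λ z≢u → ¬z (z , zu , z≢u))

    ¬bipartition : ⊥
    ¬bipartition with u , v , u≢v ← proper with size side u ≤? 10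
    ... | yes u≤10 = SmallSide.¬small u≢v u≤10 (size≤11 u≢v)
    -- With at least 11 vertices on the side of `u`, at most 9 remain for that of `v`.
    ... | no u≰10  = SmallSide.¬small (≢-sym u≢v)
      (arith (size side u) (size side v)
        (≤-trans (sizes-≤ side ((u≢v All.∷ All.[]) AllPairs.∷ All.[] AllPairs.∷ AllPairs.[])) n≤20) (≰⇒> u≰10))
      (size≤11 (≢-sym u≢v))
      where
      arith : ∀ α β → α + (β + 0) ≤ 20 → 11 ≤ α → β ≤ 10
      arith α β h h′ = linear 1 (h ⊞ h′) (solve (α ∷ β ∷ []))

  impossible : ⊥
  impossible = ¬more part λ y → [ ⊥-elim ∘ ¬bipartition , id ]′ (dichotomy part y)
    where part = gallaiPartition c

-- Books in colourings

module _ {n} (f : Coloring 3 (K n)) where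

  private
    pick : ∀ {x y : Fin n} → Dec (x ≡ y) → Fin 3
    pick (yes _)          = 0F
    pick {x} {y} (no x≢y) = colour f x y x≢y

    pick-≢ : ∀ {x y} (x≟y : Dec (x ≡ y)) (x≢y : x ≢ y) → pick x≟y ≡ colour f x y x≢y
    pick-≢ (yes x≡y) x≢y = contradiction x≡y x≢y
    pick-≢ (no _)    _   = refl

    pick-sym : ∀ {x y} (x≟y : Dec (x ≡ y)) (y≟x : Dec (y ≡ x)) → pick x≟y ≡ pick y≟x
    pick-sym (yes _)   (yes _)   = refl
    pick-sym (yes x≡y) (no y≢x)  = contradiction (sym x≡y) y≢x
    pick-sym (no x≢y)  (yes y≡x) = contradiction (sym y≡x) x≢y
    pick-sym (no x≢y)  (no _)    = colour-sym f _ _ x≢y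

    colour′ : Fin n → Fin n → Fin 3
    colour′ x y = pick (x ≟ y)

  colour′-≢ : ∀ {x y} (x≢y : x ≢ y) → colour′ x y ≡ colour f x y x≢y
  colour′-≢ = pick-≢ (_ ≟ _)

  -- The diagonal gets the junk colour 0F.
  totalise : Gallai f → GallaiColoring n
  totalise gal = record
    { col        = colour′
    ; col-sym    = λ x y → pick-sym (x ≟ y) (y ≟ x)
    ; no-rainbow = λ x y z xy≢xz xy≢yz → decidable-stable (colour′ x z ≟ colour′ y z) λ xz≢yz →
        -- If two of the vertices coincided, two of the three colours would agree, so only genuine
        -- triangles remain.
        let x≢y : x ≢ y
            x≢y = λ { refl → xz≢yz refl }
            x≢z : x ≢ z
            x≢z = λ { refl → xy≢yz (pick-sym (x ≟ y) (y ≟ x)) }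
            y≢z : y ≢ z
            y≢z = λ { refl → xy≢xz refl }
        in gal (x , y , z , x≢y , x≢z , y≢z
               , (λ eq → xy≢xz (trans (colour′-≢ x≢y) (trans eq (sym (colour′-≢ x≢z)))))
               , (λ eq → xy≢yz (trans (colour′-≢ x≢y) (trans eq (sym (colour′-≢ y≢z)))))
               , (λ eq → xz≢yz (trans (colour′-≢ x≢z) (trans eq (sym (colour′-≢ y≢z))))))
    }

module _ {n} (f : Coloring 3 (K n)) (gal : Gallai f) where

  private
    c = totalise f gal

  book : ∀ {k e x y} → x ≢ y → col c x y ≢ e → k ≤ count (page? c e x y) →
         Σ[ φ ∈ Copy (Book k) (K n) ] UsesAtMost 2 f φ
  book {k} {e} {x} {y} x≢y xy≢e k≤pages = φ , ∁ ⁅ e ⁆ , two , colours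
    where
    chosen = choose k (page? c e x y) k≤pages
    g = proj₁ chosen
    g-injective = proj₁ (proj₂ chosen)
    page = proj₂ (proj₂ chosen)
    place : Vertex (Book k) → Fin n
    place (inj₁ 0F)      = x
    place (inj₁ 1F)      = y
    place (inj₂ (i , _)) = g i
    place-injective : ∀ {s t} → place s ≡ place t → s ≡ t
    place-injective {inj₁ 0F}      {inj₁ 0F}       _  = refl
    place-injective {inj₁ 0F}      {inj₁ 1F}       eq = contradiction eq x≢y
    place-injective {inj₁ 1F}      {inj₁ 0F}       eq = contradiction (sym eq) x≢y
    place-injective {inj₁ 1F}      {inj₁ 1F}       _  = refl
    place-injective {inj₁ 0F}      {inj₂ (i , _)}  eq = contradiction (sym eq)
        (proj₁ (proj₁ (page i)))
    place-injective {inj₁ 1F}      {inj₂ (i , _)}  eq = contradiction (sym eq)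
        (proj₁ (proj₂ (page i)))
    place-injective {inj₂ (i , _)} {inj₁ 0F}       eq = contradiction eq (proj₁ (proj₁ (page i)))
    place-injective {inj₂ (i , _)} {inj₁ 1F}       eq = contradiction eq (proj₁ (proj₂ (page i)))
    place-injective {inj₂ (i , 0F)} {inj₂ (j , 0F)} eq = cong (λ i → inj₂ (i , 0F)) (g-injective eq)
    φ : Copy (Book k) (K n)
    φ = record
      { to           = place
      ; to-injective = place-injective
      -- Adjacency in `K n` is inequality, so injectivity gives it.
      ; to-adj       = λ {s} {t} st eq → adj-irrefl (Book k) {s} {t} (place-injective eq) st
      }
    two : ∣ ∁ ⁅ e ⁆ ∣ ≤ 2
    two = ≤-reflexive (trans (∣∁p∣≡n∸∣p∣ ⁅ e ⁆) (cong (3 ∸_) (∣⁅x⁆∣≡1 e)))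
    avoided : ∀ s t → Adj (Book k) s t → col c (place s) (place t) ≢ e
    avoided (inj₁ 0F)       (inj₁ 0F)       st = contradiction refl st
    avoided (inj₁ 0F)       (inj₁ 1F)       _  = xy≢e
    avoided (inj₁ 1F)       (inj₁ 0F)       _  = xy≢e ∘ trans (col-sym c x y)
    avoided (inj₁ 1F)       (inj₁ 1F)       st = contradiction refl st
    avoided (inj₁ 0F)       (inj₂ (i , _))  _  = proj₂ (proj₁ (page i))
    avoided (inj₁ 1F)       (inj₂ (i , _))  _  = proj₂ (proj₂ (page i))
    avoided (inj₂ (i , _))  (inj₁ 0F)       _  = proj₂ (proj₁ (page i)) ∘ trans (col-sym c x (g i))
    avoided (inj₂ (i , _))  (inj₁ 1F)       _  = proj₂ (proj₂ (page i)) ∘ trans (col-sym c y (g i))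
    avoided (inj₂ (_ , 0F)) (inj₂ (_ , 0F)) (_ , 0≢0) = contradiction refl 0≢0
    colours : ∀ s t (st : Adj (Book k) s t) → colour f (place s) (place t)
        (to-adj φ {s} {t} st) ∈ ∁ ⁅ e ⁆
    colours s t st = x∉p⇒x∈∁p (x≢y⇒x∉⁅y⁆ λ eq →
      avoided s t st (trans (colour′-≢ f (to-adj φ {s} {t} st)) eq))

arrows-20 : GallaiArrows 3 2 (Book 12) 20
arrows-20 f gal = case found of λ where
    (yes (e , x , y , x≢y , xy≢e , 12≤)) → book f gal x≢y xy≢e 12≤
    (no none) → ⊥-elim (Twenty.impossible refl (totalise f gal) λ e x y x≢y xy≢e →
      ≮⇒≥ λ 11< → none (e , x , y , x≢y , xy≢e , 11<))
  where
  c = totalise f gal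
  found = any? λ e → any? λ x → any? λ y →
            ¬? (x ≟ y) ×-dec ¬? (col c x y ≟ e) ×-dec (12 ≤? pages c e x y)

-- The lower bound

missedColour : (C : Subset 3) → ∣ C ∣ ≤ 2 → ∃ λ e → e ∉ C
missedColour (false Vec.∷ _)                                 _ = 0F , λ ()
missedColour (true Vec.∷ false Vec.∷ _)                      _ = 1F , λ { (Vec.there ()) }
missedColour (true Vec.∷ true Vec.∷ false Vec.∷ Vec.[])      _ = 2F ,
    λ { (Vec.there (Vec.there ())) }
missedColour (true Vec.∷ true Vec.∷ true Vec.∷ Vec.[])       (s≤s (s≤s ()))

module _ {n} (c : GallaiColoring n) where

  toColoring : Coloring 3 (K n)
  toColoring = record { colour = λ x y _ → col c x y ; colour-sym = λ x y _ → col-sym c x y }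

  toColoring-gallai : Gallai toColoring
  toColoring-gallai (x , y , z , _ , _ , _ , xy≢xz , xy≢yz , xz≢yz) =
    xz≢yz (no-rainbow c x y z xy≢xz xy≢yz)

  -- Converse of `book`: in a copy whose colours miss `e`, the leaves are pages of the spine. The
  -- embedding `ι` lets the copy live in a smaller complete graph.
  book-pages : ∀ {k q} (ι : Fin q → Fin n) → Injective _≡_ _≡_ ι → (φ : Copy (Book k) (K q))
      (C : Subset 3) →
               (∀ s t → Adj (Book k) s t → col c (ι (to φ s)) (ι (to φ t)) ∈ C) →
               ∀ {e} → e ∉ C → k ≤ pages c e (ι (to φ (inj₁ 0F))) (ι (to φ (inj₁ 1F)))
  book-pages {k} ι ι-inj φ C inC {e} e∉C = injection-≤-count k
      (page? c e _ _) leaf leaf-injective λ i →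
      ((λ eq → case to-injective φ (ι-inj eq) of λ ()) , avoids tt)
    , ((λ eq → case to-injective φ (ι-inj eq) of λ ()) , avoids tt)
    where
    leaf : Fin k → Fin n
    leaf i = ι (to φ (inj₂ (i , 0F)))
    leaf-injective : Injective _≡_ _≡_ leaf
    leaf-injective eq with refl ← to-injective φ (ι-inj eq) = refl
    avoids : ∀ {s t} → Adj (Book k) s t → col c (ι (to φ s)) (ι (to φ t)) ≢ e
    avoids {s} {t} st eq = e∉C (subst (_∈ C) eq (inC s t st))

-- Colour 0F joins Fin 9 to the rest; 1F is the Paley graph of order 9 (the rook's
-- graph of the 3 × 3 board) on the first part and the Paley graph of order 13
-- induced on 0, …, 9 on the second.
paleyColour : ℕ → ℕ → Fin 3
paleyColour x y =
  if x <ᵇ 9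
  then (if y <ᵇ 9 then choice ((x / 3 ≡ᵇ y / 3) ∨ (x % 3 ≡ᵇ y % 3)) else 0F)
  else (if y <ᵇ 9 then 0F else choice (square ∣ x - y ∣))
  where
  choice : Bool → Fin 3
  choice b = if b then 1F else 2F
  square : ℕ → Bool
  -- The nonzero squares modulo 13 also include 10 and 12, but differences within the second part
  -- are at most 9.
  square d = (d ≡ᵇ 1) ∨ (d ≡ᵇ 3) ∨ (d ≡ᵇ 4) ∨ (d ≡ᵇ 9)

paleyColour′ : Fin 19 → Fin 19 → Fin 3
paleyColour′ x y = paleyColour (toℕ x) (toℕ y)

paley : GallaiColoring 19
paley = record
  { col        = paleyColour′
  ; col-sym    = toWitness {a? = all? λ x → all? λ y → paleyColour′ x y ≟ paleyColour′ y x} _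
  ; no-rainbow = toWitness {a? = all? λ x → all? λ y → all? λ z →
      ¬? (paleyColour′ x y ≟ paleyColour′ x z) →-dec (¬? (paleyColour′ x y ≟ paleyColour′ y z) →-dec
      (paleyColour′ x z ≟ paleyColour′ y z))} _
  }

opaque
  unfolding sum

  -- Adjacent vertices have one common neighbour in the Paley graph of order 9 and two in that of
  -- order 13, likewise in the complements. So when `e` is not `0F` a spine inside a part has at
  -- most `10 + 1` or `9 + 2` pages, and a crossing one at most `4 + 6`. Avoiding `0F` leaves at
  -- most 8.
  paley-bookFree : BookFree paley
  paley-bookFree = toWitness {a? = all? λ e → all? λ x → all? λ y →
    ¬? (x ≟ y) →-dec (¬? (paleyColour′ x y ≟ e) →-dec (pages paley e x y ≤? 11))} _

-- Minimality concerns every smaller order, so the colouring of order 19 is restricted to its first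
-- `q` vertices.
¬arrows : ∀ {q} → q ≤ 19 → ¬ GallaiArrows 3 2 (Book 12) q
¬arrows {q} q≤19 arrows =
  let φ , C , ∣C∣≤2 , inC = arrows (toColoring c) (toColoring-gallai c)
      e , e∉C = missedColour C ∣C∣≤2
      x≢y = λ eq → contradiction (to-injective φ (ι-injective eq)) λ ()
  in <⇒≱ (book-pages paley ι ι-injective φ C inC e∉C)
       (paley-bookFree e (ι (to φ (inj₁ 0F))) (ι (to φ (inj₁ 1F))) x≢y
         λ eq → e∉C (subst (_∈ C) eq (inC (inj₁ 0F) (inj₁ 1F) λ ())))
  where
  ι : Fin q → Fin 19
  ι x = inject≤ x q≤19
  ι-injective : Injective _≡_ _≡_ ι
  ι-injective {i} {j} = inject≤-injective q≤19 q≤19 i j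
  c = restrict ι paley

theorem4p8 : gr^ 3 [ 2 ] Book 12 ≐ 20
theorem4p8 = arrows-20 , λ q arrows → ≮⇒≥ λ q<20 → ¬arrows (≤-pred q<20) arrows
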